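{- Given a temporal graph $(G,\lambda)$ of lifetime $\tau$, a positive integer $h$, and distinct vertices $s,z\in V(G)$, one can decide whether there is a snapshot $s,z$-cut in $(G,\lambda)$ of size at most $h$ in time $O(\tau^{h}\cdot(|V(G)|+|E(G)|))$.
   Context: A graph is a finite undirected loopless multigraph. A temporal graph is a pair $(G,\lambda)$ with $G$ a graph and $\lambda:E(G)\to\mathbb{N}\setminus\{0\}$; an edge $e$ is active at timestep $\lambda(e)$. It is assumed that edges with the same endpoints have distinct values of $\lambda$. The lifetime is $\tau=\max_{e\in E(G)}\lambda(e)$, and $[\tau]=\{1,\dots,\tau\}$. A temporal $s,z$-walk is a sequence $(s=x_0,e_1,x_1,\dots,e_q,x_q=z)$ where $e_i$ has endpoints $x_{i-1}x_i$ and $\lambda(e_1)\le\dots\le\lambda(e_q)$; it is a temporal $s,z$-path if its vertices are pairwise distinct. A set $S\subseteq[\tau]$ is a snapshot $s,z$-cut if every temporal $s,z$-path uses an edge active at some timestep in $S$. -}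

module Defs where

open import Data.Bool.Base using (Bool; true; false; if_then_else_)
open import Data.Fin.Base using (Fin; toℕ; fromℕ<)
open import Data.Fin.Subset using (Subset; _∈_; ∣_∣)
open import Data.List.Base using (List; []; _∷_; map; tabulate)
open import Data.List.Extrema.Nat using (max)
open import Data.List.Relation.Unary.Any using (Any)
open import Data.List.Relation.Unary.Linked using (Linked)
open import Data.List.Relation.Unary.Unique.Propositional using (Unique)
open import Data.Nat.Base using (ℕ; suc; pred; _+_; _≤_; _≡ᵇ_; _<ᵇ_)
open import Data.Nat.Properties using (_<?_)
open import Data.Product.Base using (∃-syntax; _×_; _,_; proj₁; proj₂)
open import Data.Sum.Base using (_⊎_)
open import Function.Base using (_∘_)
open import Relation.Binary.PropositionalEquality.Core using (_≡_; _≢_)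
open import Relation.Nullary using (yes; no)

------------------------------------------------------------------------
-- Temporal graphs

-- The two endpoints of an edge are listed in an arbitrary order; `Joins`
-- forgets that order.
record TemporalGraph : Set where
  field
    ∣V∣ ∣E∣ : ℕ

  Vertex = Fin ∣V∣
  Edge   = Fin ∣E∣

  field
    ends     : Edge → Vertex × Vertex
    loopless : ∀ e → proj₁ (ends e) ≢ proj₂ (ends e)

  Joins : Edge → Vertex → Vertex → Set
  Joins e u v = ends e ≡ (u , v) ⊎ ends e ≡ (v , u)

  field
    time          : Edge → ℕ
    time-positive : ∀ e → 1 ≤ time e
    time-distinct : ∀ {e f u v} → Joins e u v → Joins f u v →
                    e ≢ f → time e ≢ time f

  -- The maximum is taken among the positive integers, so it is 1 when there
  -- are no edges; otherwise the default 1 is irrelevant by `time-positive`.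
  lifetime : ℕ
  lifetime = max 1 (tabulate time)

  data Walk : Vertex → Vertex → Set where
    stop : ∀ {u} → Walk u u
    step : ∀ {u v w} (e : Edge) → Joins e u v → Walk v w → Walk u w

  edges : ∀ {u v} → Walk u v → List Edge
  edges stop         = []
  edges (step e _ p) = e ∷ edges p

  vertices : ∀ {u v} → Walk u v → List Vertex
  vertices {u} stop         = u ∷ []
  vertices {u} (step _ _ p) = u ∷ vertices p

  record TemporalPath (s z : Vertex) : Set where
    field
      walk     : Walk s z
      temporal : Linked _≤_ (map time (edges walk))
      path     : Unique (vertices walk)

  -- The index i stands for the timestep 1 + i of {1, …, lifetime}.
  ActiveIn : Subset lifetime → Edge → Set
  ActiveIn S e = ∃[ i ] i ∈ S × time e ≡ suc (toℕ i)

  SnapshotCut : Vertex → Vertex → Subset lifetime → Set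
  SnapshotCut s z S =
    (p : TemporalPath s z) → Any (ActiveIn S) (edges (TemporalPath.walk p))

  HasSnapshotCut : ℕ → Vertex → Vertex → Set
  HasSnapshotCut h s z = ∃[ S ] ∣ S ∣ ≤ h × SnapshotCut s z S

------------------------------------------------------------------------
-- Random access machine

-- Unit-cost RAM programs in structured form, over registers and arrays named
-- by numerals; a program mentions finitely many of them.  The arithmetic is
-- only increment and decrement, as in a successor RAM: in t steps no number
-- exceeds t plus the largest number in the input or the program, so unit cost
-- cannot be abused by building huge numbers.

infixr 4 _⨾_

data Expr : Set where
  lit     : ℕ → Expr
  reg     : ℕ → Expr
  arr     : ℕ → Expr → Expr
  inc dec : Expr → Expr

data Test : Set where
  eq lt : Expr → Expr → Test

data Program : Set where
  skip  : Program
  set   : ℕ → Expr → Program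
  store : ℕ → Expr → Expr → Program
  _⨾_   : Program → Program → Program
  cond  : Test → Program → Program → Program
  while : Test → Program → Program

record State : Set where
  constructor state
  field
    register : ℕ → ℕ
    array    : ℕ → ℕ → ℕ

open State public

_[_↦_] : ∀ {A : Set} → (ℕ → A) → ℕ → A → ℕ → A
(f [ x ↦ a ]) y = if x ≡ᵇ y then a else f y

value : Expr → State → ℕ
value (lit k)   σ = k
value (reg x)   σ = register σ x
value (arr a i) σ = array σ a (value i σ)
value (inc i)   σ = suc (value i σ)
value (dec i)   σ = pred (value i σ)

holds : Test → State → Bool
holds (eq i j) σ = value i σ ≡ᵇ value j σ
holds (lt i j) σ = value i σ <ᵇ value j σ

setRegister : ℕ → ℕ → State → State
setRegister x v (state r m) = state (r [ x ↦ v ]) m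

setArray : ℕ → ℕ → ℕ → State → State
setArray a i v (state r m) = state r (m [ a ↦ m a [ i ↦ v ] ])

exprCost : Expr → ℕ
exprCost (lit _)   = 1
exprCost (reg _)   = 1
exprCost (arr _ i) = suc (exprCost i)
exprCost (inc i)   = suc (exprCost i)
exprCost (dec i)   = suc (exprCost i)

testCost : Test → ℕ
testCost (eq i j) = suc (exprCost i + exprCost j)
testCost (lt i j) = suc (exprCost i + exprCost j)

-- ⟨ P , σ ⟩⇓⟨ σ′ , t ⟩: started in σ, P halts in σ′ after exactly t steps.
data ⟨_,_⟩⇓⟨_,_⟩ : Program → State → State → ℕ → Set where
  skip⇓  : ∀ {σ} → ⟨ skip , σ ⟩⇓⟨ σ , 1 ⟩
  set⇓   : ∀ {x i σ} →
           ⟨ set x i , σ ⟩⇓⟨ setRegister x (value i σ) σ , suc (exprCost i) ⟩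
  store⇓ : ∀ {a i j σ} →
           ⟨ store a i j , σ ⟩⇓⟨ setArray a (value i σ) (value j σ) σ
                               , suc (exprCost i + exprCost j) ⟩
  ⨾⇓     : ∀ {P Q σ σ′ σ″ t u} →
           ⟨ P , σ ⟩⇓⟨ σ′ , t ⟩ → ⟨ Q , σ′ ⟩⇓⟨ σ″ , u ⟩ →
           ⟨ P ⨾ Q , σ ⟩⇓⟨ σ″ , t + u ⟩
  true⇓  : ∀ {b P Q σ σ′ t} → holds b σ ≡ true →
           ⟨ P , σ ⟩⇓⟨ σ′ , t ⟩ →
           ⟨ cond b P Q , σ ⟩⇓⟨ σ′ , testCost b + t ⟩
  false⇓ : ∀ {b P Q σ σ′ t} → holds b σ ≡ false →
           ⟨ Q , σ ⟩⇓⟨ σ′ , t ⟩ →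
           ⟨ cond b P Q , σ ⟩⇓⟨ σ′ , testCost b + t ⟩
  loop⇓  : ∀ {b P σ σ′ σ″ t u} → holds b σ ≡ true →
           ⟨ P , σ ⟩⇓⟨ σ′ , t ⟩ → ⟨ while b P , σ′ ⟩⇓⟨ σ″ , u ⟩ →
           ⟨ while b P , σ ⟩⇓⟨ σ″ , testCost b + (t + u) ⟩
  exit⇓  : ∀ {b P σ} → holds b σ ≡ false →
           ⟨ while b P , σ ⟩⇓⟨ σ , testCost b ⟩

------------------------------------------------------------------------
-- Input and output

toArray : ∀ {m} → (Fin m → ℕ) → ℕ → ℕ
toArray {m} f i with i <? m
... | yes i<m = f (fromℕ< i<m)
... | no  _   = 0

-- Registers 0–4 hold |V|, |E|, h, s, z.  Arrays 0–2 list, for each edge, its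
-- two endpoints and its time, with the edges in no particular order.  All
-- else is 0; in particular the lifetime is not part of the input.
input : ∀ G → ℕ → (s z : TemporalGraph.Vertex G) → State
input G h s z = state registers arrays
  where
  open TemporalGraph G

  registers : ℕ → ℕ
  registers 0 = ∣V∣
  registers 1 = ∣E∣
  registers 2 = h
  registers 3 = toℕ s
  registers 4 = toℕ z
  registers _ = 0

  arrays : ℕ → ℕ → ℕ
  arrays 0 = toArray (toℕ ∘ proj₁ ∘ ends)
  arrays 1 = toArray (toℕ ∘ proj₂ ∘ ends)
  arrays 2 = toArray time
  arrays _ = λ _ → 0

output : State → ℕ
output σ = register σ 0

{-# OPTIONS --safe #-}
module Submission where

-- If h ≥ |E|, the set of all timesteps of edges is a cut.  Otherwise try every
-- h-tuple of timesteps in turn; since repetitions are allowed, the tuples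
-- cover all nonempty sets of at most h timesteps, and there are exactly
-- lifetime ^ h of them.  As h < |E|, each may be given time O(|V| + |E|), which
-- suffices for deleting its timesteps and searching from s: keep the edges
-- leaving each vertex in a list of decreasing time, and when the search
-- arrives at a vertex at time a, remove from its list all edges of time at
-- least a.  An edge removed once need never be looked at again, because any
-- later use of it would arrive at its other end at the same time.  The lists
-- are set up in time O(lifetime · (|V| + |E|)) by scanning all edges once for
-- each timestep; this is affordable since h ≥ 1.

open import Defs
open import Data.Bool.Base using (true; false; T)
open import Data.Empty using (⊥; ⊥-elim)
open import Data.Fin.Base as Fin using (Fin; toℕ; fromℕ<)
open import Data.Fin.Properties as Fin using (toℕ<n; toℕ≤pred[n]; toℕ-fromℕ<; fromℕ<-toℕ; toℕ-injective)
open import Data.Fin.Subset using (Subset; inside; outside; _∈_; ∣_∣; ⁅_⁆; _∪_) renaming (⊥ to ∅)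
open import Data.Fin.Subset.Properties using (∣⊥∣≡0; ∣⁅x⁆∣≡1; x∈⁅x⁆; x∈p∪q⁺)
open import Data.List.Base using ([]; _∷_; List; map; tabulate)
open import Data.List.Extrema.Nat using (max≤v⁺; xs≤max; ⊥≤max)
open import Data.List.Membership.DecPropositional using (_∈?_)
open import Data.List.Membership.Propositional using () renaming (_∈_ to _∈ₗ_)
open import Data.List.Relation.Unary.All as All using (All; []; _∷_)
open import Data.List.Relation.Unary.All.Properties using (tabulate⁺; tabulate⁻; ¬Any⇒All¬; All¬⇒¬Any)
open import Data.List.Relation.Unary.AllPairs using ([]; _∷_)
open import Data.List.Relation.Unary.Any as Any using (here; there)
open import Data.List.Relation.Unary.Linked using (Linked; []; [-]; _∷_)
open import Data.List.Relation.Unary.Unique.Propositional using (Unique)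
open import Data.Nat.Base
open import Data.Nat.Properties
open import Data.Product.Base using (∃-syntax; Σ-syntax; _×_; _,_; proj₁; proj₂)
open import Data.Sum.Base using (_⊎_; inj₁; inj₂; map₂)
open import Data.Unit.Base using (tt)
open import Data.Vec.Base using ([]; _∷_; here; there)
open import Function.Base using (_∘_)
open import Relation.Binary.Definitions using (tri<; tri≈; tri>)
open import Relation.Binary.PropositionalEquality
open import Relation.Nullary using (¬_; contradiction; Dec; yes; no)
open import Relation.Nullary.Decidable using (_⊎-dec_; _×-dec_)

-- A round must be linear although the previous one leaves its data behind. A deleted timestep is
-- marked with the number of the current round, so no mark has to be erased; the queue is rewound
-- and overwritten; moving on to the next tuple visits all its digits, which costs O(h) and is
-- affordable for h < |E|.
--
-- A vertex may enter the queue many times, with arrival times in any order. What bounds the queue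
-- is the lists: there are two nodes per edge, one for each direction, and an entry other than the
-- one for `s` is made only when a node is removed.
--
-- The search finds walks, whereas cuts are about paths. Cutting a cycle out of a temporal walk
-- keeps the times in order and adds no edge, so a walk that avoids some timesteps yields a path
-- that avoids them.
--
-- Loop invariants carry a bound on the iterations left, so that termination, cost and correctness
-- come out of a single induction.

-- Program logic with running times

Halts : Program → State → (State → Set) → ℕ → Set
Halts P σ Q T = ∃[ σ′ ] ∃[ t ] ⟨ P , σ ⟩⇓⟨ σ′ , t ⟩ × t ≤ T × Q σ′

Holds : Test → State → Set
Holds (eq i j) σ = value i σ ≡ value j σ
Holds (lt i j) σ = value i σ < value j σ

data Outcome (b : Test) (σ : State) : Set where
  passes : holds b σ ≡ true  → Holds b σ   → Outcome b σ
  fails  : holds b σ ≡ false → ¬ Holds b σ → Outcome b σ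

outcome : ∀ b σ → Outcome b σ
outcome (eq i j) σ with value i σ ≡ᵇ value j σ in p
... | true  = passes p (≡ᵇ⇒≡ _ _ (subst T (sym p) tt))
... | false = fails p λ q → subst T p (≡⇒≡ᵇ _ _ q)
outcome (lt i j) σ with value i σ <ᵇ value j σ in p
... | true  = passes p (<ᵇ⇒< _ _ (subst T (sym p) tt))
... | false = fails p λ q → subst T p (<⇒<ᵇ q)

-- The name keeps the terms for successive states in wp linear in size, and so
-- does the equation in the clause for set: inlined, both values would contain
-- a copy of the previous state.
assign : ℕ → Expr → Expr → State → State
assign a i j σ = setArray a (value i σ) (value j σ) σ

wp : Program → (State → Set) → State → Set
wp skip          Q σ = Q σ
wp (set x i)     Q σ = ∀ v → v ≡ value i σ → Q (setRegister x v σ)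
wp (store a i j) Q σ = Q (assign a i j σ)
wp (P ⨾ R)       Q σ = wp P (wp R Q) σ
wp (cond b P R)  Q σ = (Holds b σ → wp P Q σ) × (¬ Holds b σ → wp R Q σ)
wp (while _ _)   Q σ = ⊥

-- Depends on the program text alone, and adds the two branches of a conditional to avoid maxima.
-- The value at `while` is harmless, since `wp` is empty there: loops go through `iterate`.
bound : Program → ℕ
bound skip          = 1
bound (set x i)     = suc (exprCost i)
bound (store a i j) = suc (exprCost i + exprCost j)
bound (P ⨾ R)       = bound P + bound R
bound (cond b P R)  = testCost b + (bound P + bound R)
bound (while _ _)   = 0

infixl 1 _andThen_

_andThen_ : ∀ {P R σ Q Q′ T U} → Halts P σ Q T →
            (∀ σ′ → Q σ′ → Halts R σ′ Q′ U) → Halts (P ⨾ R) σ Q′ (T + U)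
(σ′ , t , run , t≤T , q) andThen k with k _ q
... | σ″ , u , run′ , u≤U , q′ = σ″ , t + u , ⨾⇓ run run′ , +-mono-≤ t≤T u≤U , q′

branch : ∀ b {P R σ Q T U} → (Holds b σ → Halts P σ Q T) → (¬ Holds b σ → Halts R σ Q U) →
         Halts (cond b P R) σ Q (testCost b + (T + U))
branch b {σ = σ} l r with outcome b σ
... | passes p h = let σ′ , t , run , t≤ , q = l h in
  σ′ , _ , true⇓ p run , +-monoʳ-≤ (testCost b) (≤-trans t≤ (m≤m+n _ _)) , q
... | fails p h = let σ′ , t , run , t≤ , q = r h in
  σ′ , _ , false⇓ p run , +-monoʳ-≤ (testCost b) (≤-trans t≤ (m≤n+m _ _)) , q

straight : ∀ P {Q σ} → wp P Q σ → Halts P σ Q (bound P)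
straight skip          q = _ , _ , skip⇓ , ≤-refl , q
straight (set x i)     q = _ , _ , set⇓ , ≤-refl , q _ refl
straight (store a i j) q = _ , _ , store⇓ , ≤-refl , q
straight (P ⨾ R)       q = straight P q andThen λ _ → straight R
straight (cond b P R) (l , r) = branch b (λ h → straight P (l h)) (λ h → straight R (r h))

relax : ∀ {P σ Q T U} → T ≤ U → Halts P σ Q T → Halts P σ Q U
relax T≤U (σ′ , t , run , t≤T , q) = σ′ , t , run , ≤-trans t≤T T≤U , q

consequence : ∀ {P σ Q R T} → (∀ σ′ → Q σ′ → R σ′) → Halts P σ Q T → Halts P σ R T
consequence f (σ′ , t , run , t≤T , q) = σ′ , t , run , t≤T , f _ q

-- The index of I bounds the number of iterations left.
iterate : ∀ {b P c} (I : ℕ → State → Set) →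
          (∀ n σ → I n σ → Holds b σ → ∃[ m ] n ≡ suc m × Halts P σ (I m) c) →
          ∀ {n σ} → I n σ →
          Halts (while b P) σ (λ σ′ → (∃[ m ] I m σ′) × ¬ Holds b σ′)
                (testCost b + n * (testCost b + c))
iterate {b} {P} {c} I body {n} {σ} i with outcome b σ
... | fails p h = σ , _ , exit⇓ p , m≤m+n _ _ , (n , i) , h
... | passes p h with body n σ i h
...   | m , refl , σ′ , t , run , t≤c , i′ with iterate I body i′
...     | σ″ , u , run′ , u≤ , q =
  σ″ , _ , loop⇓ p run run′ , +-monoʳ-≤ (testCost b) total , q
  where
  total : t + u ≤ testCost b + c + m * (testCost b + c)
  total = begin
    t + u                                             ≤⟨ +-mono-≤ t≤c u≤ ⟩
    c + (testCost b + m * (testCost b + c))           ≡⟨ +-assoc c _ _ ⟨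
    c + testCost b + m * (testCost b + c)             ≡⟨ cong (_+ m * (testCost b + c)) (+-comm c _) ⟩
    testCost b + c + m * (testCost b + c)             ∎
    where open ≤-Reasoning

updated : ∀ {A : Set} (f : ℕ → A) x {a} → (f [ x ↦ a ]) x ≡ a
updated f x {a} with x ≡ᵇ x in p
... | true  = refl
... | false = ⊥-elim (subst T p (≡⇒≡ᵇ x x refl))

kept : ∀ {A : Set} (f : ℕ → A) {x y a} → x ≢ y → (f [ x ↦ a ]) y ≡ f y
kept f {x} {y} x≢y with x ≡ᵇ y in p
... | false = refl
... | true  = contradiction (≡ᵇ⇒≡ x y (subst T (sym p) tt)) x≢y

for : ℕ → Expr → Program → Program
for x l P = set x (lit 0) ⨾ while (lt (reg x) l) (P ⨾ set x (inc (reg x)))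

increment : ℕ → State → State
increment x σ = setRegister x (suc (register σ x)) σ

-- `J` may speak of the counter, so the body has to establish it for the state after the increment.
-- The limit is evaluated anew at every test, so `J` has to fix its value. The initial assignment
-- costs 2, a test 2 + `exprCost l`, an increment 3.
loop : ∀ {P} x l {L c σ} (J : State → Set) →
       (∀ σ → J σ → value l σ ≡ L) →
       (∀ σ → J σ → register σ x < L →
         Halts P σ (λ σ′ → register σ′ x ≡ register σ x × J (increment x σ′)) c) →
       J (setRegister x 0 σ) →
       Halts (for x l P) σ (λ σ′ → J σ′ × register σ′ x ≡ L)
             (4 + exprCost l + L * (2 + exprCost l + (c + 3)))
loop {P} x l {L} {c} {σ} J limit body j =
  straight (set x (lit 0)) {I L} (λ { _ refl → j , start })
  andThen λ _ i → consequence finish (iterate I round {L} i)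
  where
  I : ℕ → State → Set
  I n σ = J σ × n + register σ x ≡ L

  start : L + register (setRegister x 0 σ) x ≡ L
  start = trans (cong (L +_) (updated (register σ) x)) (+-identityʳ L)

  finish : ∀ σ′ → (∃[ m ] I m σ′) × ¬ Holds (lt (reg x) l) σ′ → J σ′ × register σ′ x ≡ L
  finish σ′ ((m , j , e) , done) =
    j , ≤-antisym (m+n≤o⇒n≤o m (≤-reflexive e)) (≮⇒≥ (subst (λ v → ¬ _ < v) (limit _ j) done))

  round : ∀ n σ → I n σ → Holds (lt (reg x) l) σ →
          ∃[ m ] n ≡ suc m × Halts (P ⨾ set x (inc (reg x))) σ (I m) (c + 3)
  round zero σ (j , e) x<l =
    contradiction (subst₂ _<_ e (limit _ j) x<l) (<-irrefl refl)
  round (suc m) σ (j , e) x<l =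
    m , refl , (body σ j (subst (_ <_) (limit _ j) x<l) andThen λ σ′ (same , j′) →
      straight (set x (inc (reg x))) {I m} (λ { _ refl → j′ , advanced {σ′} same }))
    where
    advanced : ∀ {σ′} → register σ′ x ≡ register σ x → m + register (increment x σ′) x ≡ L
    advanced {σ′} same = begin
      m + register (increment x σ′) x ≡⟨ cong (m +_) (updated (register σ′) x) ⟩
      m + suc (register σ′ x)         ≡⟨ cong (λ v → m + suc v) same ⟩
      m + suc (register σ x)          ≡⟨ +-suc m _ ⟩
      suc m + register σ x            ≡⟨ e ⟩
      L                               ∎
      where open ≡-Reasoning

-- Counting, for use in potentials

count : {P : ℕ → Set} → (∀ k → Dec (P k)) → ℕ → ℕ
count P? zero = 0
count P? (suc n) with P? n
... | yes _ = suc (count P? n)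
... | no  _ = count P? n

count≤ : ∀ {P : ℕ → Set} (P? : ∀ k → Dec (P k)) n → count P? n ≤ n
count≤ P? zero = z≤n
count≤ P? (suc n) with P? n
... | yes _ = s≤s (count≤ P? n)
... | no  _ = m≤n⇒m≤1+n (count≤ P? n)

module _ {P Q : ℕ → Set} (P? : ∀ k → Dec (P k)) (Q? : ∀ k → Dec (Q k)) where

  count-mono : ∀ n → (∀ {k} → k < n → P k → Q k) → count P? n ≤ count Q? n
  count-mono zero    P⊆Q = z≤n
  count-mono (suc n) P⊆Q with P? n | Q? n | count-mono n (λ k<n → P⊆Q (m<n⇒m<1+n k<n))
  ... | yes p | yes q | ih = s≤s ih
  ... | yes p | no ¬q | ih = contradiction (P⊆Q ≤-refl p) ¬q
  ... | no ¬p | yes q | ih = m≤n⇒m≤1+n ih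
  ... | no ¬p | no ¬q | ih = ih

  count-strict : ∀ {x} n → (∀ {k} → k < n → P k → Q k) → x < n → Q x → ¬ P x →
                 count P? n < count Q? n
  count-strict {x} (suc n) P⊆Q (s≤s x≤n) qx ¬px
    with P? n | Q? n | count-mono n (λ k<n → P⊆Q (m<n⇒m<1+n k<n))
       | m≤n⇒m<n∨m≡n x≤n
  ... | yes p | no ¬q | _  | _         = contradiction (P⊆Q ≤-refl p) ¬q
  ... | yes p | yes q | _  | inj₁ x<n  = s≤s (count-strict n (λ k<n → P⊆Q (m<n⇒m<1+n k<n)) x<n qx ¬px)
  ... | yes p | yes q | _  | inj₂ refl = contradiction p ¬px
  ... | no ¬p | yes q | ih | _         = s≤s ih
  ... | no ¬p | no ¬q | _  | inj₁ x<n  = count-strict n (λ k<n → P⊆Q (m<n⇒m<1+n k<n)) x<n qx ¬px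
  ... | no ¬p | no ¬q | _  | inj₂ refl = contradiction qx ¬q

-- Tuples of digits as numerals in base `b`, least significant digit first

module _ (b : ℕ) where

  numeral : (ℕ → ℕ) → ℕ → ℕ
  numeral d zero    = 0
  numeral d (suc n) = numeral d n + d n * b ^ n

  numeral< : ∀ {d} n → (∀ {j} → j < n → d j < b) → numeral d n < b ^ n
  numeral< zero    d<b = ≤-refl
  numeral< {d} (suc n) d<b = begin-strict
    numeral d n + d n * b ^ n <⟨ +-monoˡ-< (d n * b ^ n) (numeral< n λ j<n → d<b (m<n⇒m<1+n j<n)) ⟩
    b ^ n + d n * b ^ n       ≤⟨ *-monoˡ-≤ (b ^ n) (d<b ≤-refl) ⟩
    b * b ^ n                 ∎
    where open ≤-Reasoning

  numeral-< : ∀ {d e} n → (∀ {j} → j < n → d j < b) → d n < e n →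
              numeral d (suc n) < numeral e (suc n)
  numeral-< {d} {e} n d<b dn<en = begin-strict
    numeral d n + d n * b ^ n <⟨ +-monoˡ-< (d n * b ^ n) (numeral< n d<b) ⟩
    b ^ n + d n * b ^ n       ≤⟨ *-monoˡ-≤ (b ^ n) dn<en ⟩
    e n * b ^ n               ≤⟨ m≤n+m _ _ ⟩
    numeral e n + e n * b ^ n ∎
    where open ≤-Reasoning

  -- A larger leading digit outweighs all lower digits together, so equal numerals agree from the
  -- top down.
  numeral-injective : ∀ {d e} n → (∀ {j} → j < n → d j < b) → (∀ {j} → j < n → e j < b) →
                      numeral d n ≡ numeral e n → ∀ {j} → j < n → d j ≡ e j
  numeral-injective {d} {e} (suc n) d<b e<b same (s≤s j≤n) with <-cmp (d n) (e n)
  ... | tri< d<e _ _ = contradiction same (<⇒≢ (numeral-< n (λ j<n → d<b (m<n⇒m<1+n j<n)) d<e))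
  ... | tri> _ _ gt = contradiction (sym same) (<⇒≢ (numeral-< n (λ j<n → e<b (m<n⇒m<1+n j<n)) gt))
  ... | tri≈ _ top _ with m≤n⇒m<n∨m≡n j≤n
  ...   | inj₂ refl = top
  ...   | inj₁ j<n  = numeral-injective n (λ j<n → d<b (m<n⇒m<1+n j<n)) (λ j<n → e<b (m<n⇒m<1+n j<n))
                        (+-cancelʳ-≡ _ _ _ (trans same (cong (λ c → numeral e n + c * b ^ n) (sym top)))) j<n

  numeral-cong : ∀ {d e} n → (∀ {j} → j < n → d j ≡ e j) → numeral d n ≡ numeral e n
  numeral-cong zero    d≡e = refl
  numeral-cong (suc n) d≡e =
    cong₂ _+_ (numeral-cong n λ j<n → d≡e (m<n⇒m<1+n j<n)) (cong (_* b ^ n) (d≡e ≤-refl))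

  -- Stated without subtracting the old digit.
  numeral-update : ∀ d {x i} n → i < n →
                   numeral (d [ i ↦ x ]) n + d i * b ^ i ≡ numeral d n + x * b ^ i
  numeral-update d {x} {i} (suc n) (s≤s i≤n) with m≤n⇒m<n∨m≡n i≤n
  ... | inj₂ refl = begin
    numeral (d [ i ↦ x ]) i + (d [ i ↦ x ]) i * b ^ i + d i * b ^ i
      ≡⟨ cong₂ (λ v c → v + c * b ^ i + d i * b ^ i)
               (numeral-cong i λ j<i → kept d (λ i≡j → <⇒≢ j<i (sym i≡j))) (updated d i) ⟩
    numeral d i + x * b ^ i + d i * b ^ i ≡⟨ +-assoc (numeral d i) _ _ ⟩
    numeral d i + (x * b ^ i + d i * b ^ i) ≡⟨ cong (numeral d i +_) (+-comm (x * b ^ i) _) ⟩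
    numeral d i + (d i * b ^ i + x * b ^ i) ≡⟨ +-assoc (numeral d i) _ _ ⟨
    numeral d i + d i * b ^ i + x * b ^ i ∎
    where open ≡-Reasoning
  ... | inj₁ i<n = begin
    numeral (d [ i ↦ x ]) n + (d [ i ↦ x ]) n * b ^ n + d i * b ^ i
      ≡⟨ cong (λ c → numeral (d [ i ↦ x ]) n + c * b ^ n + d i * b ^ i) (kept d (<⇒≢ i<n)) ⟩
    numeral (d [ i ↦ x ]) n + d n * b ^ n + d i * b ^ i ≡⟨ swap (numeral (d [ i ↦ x ]) n) _ _ ⟩
    numeral (d [ i ↦ x ]) n + d i * b ^ i + d n * b ^ n ≡⟨ cong (_+ d n * b ^ n) (numeral-update d n i<n) ⟩
    numeral d n + x * b ^ i + d n * b ^ n ≡⟨ swap (numeral d n) _ _ ⟩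
    numeral d n + d n * b ^ n + x * b ^ i ∎
    where
    open ≡-Reasoning
    swap : ∀ p q r → p + q + r ≡ p + r + q
    swap p q r = trans (+-assoc p q r) (trans (cong (p +_) (+-comm q r)) (sym (+-assoc p r q)))

-- Small subsets versus tuples

∣p∪q∣≤∣p∣+∣q∣ : ∀ {n} (p q : Subset n) → ∣ p ∪ q ∣ ≤ ∣ p ∣ + ∣ q ∣
∣p∪q∣≤∣p∣+∣q∣ []            []            = z≤n
∣p∪q∣≤∣p∣+∣q∣ (outside ∷ p) (outside ∷ q) = ∣p∪q∣≤∣p∣+∣q∣ p q
∣p∪q∣≤∣p∣+∣q∣ (outside ∷ p) (inside  ∷ q) =
  ≤-trans (s≤s (∣p∪q∣≤∣p∣+∣q∣ p q)) (≤-reflexive (sym (+-suc ∣ p ∣ ∣ q ∣)))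
∣p∪q∣≤∣p∣+∣q∣ (inside  ∷ p) (outside ∷ q) = s≤s (∣p∪q∣≤∣p∣+∣q∣ p q)
∣p∪q∣≤∣p∣+∣q∣ (inside  ∷ p) (inside  ∷ q) =
  s≤s (≤-trans (∣p∪q∣≤∣p∣+∣q∣ p q) (+-monoʳ-≤ ∣ p ∣ (n≤1+n _)))

image : ∀ {k n} → (Fin k → Fin n) → Subset n
image {zero}  f = ∅
image {suc k} f = ⁅ f Fin.zero ⁆ ∪ image (λ i → f (Fin.suc i))

∣image∣≤ : ∀ {k n} (f : Fin k → Fin n) → ∣ image f ∣ ≤ k
∣image∣≤ {zero}  {n} f = ≤-reflexive (∣⊥∣≡0 n)
∣image∣≤ {suc k} f = begin
  ∣ ⁅ f Fin.zero ⁆ ∪ image g ∣     ≤⟨ ∣p∪q∣≤∣p∣+∣q∣ ⁅ f Fin.zero ⁆ (image g) ⟩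
  ∣ ⁅ f Fin.zero ⁆ ∣ + ∣ image g ∣ ≤⟨ +-mono-≤ (≤-reflexive (∣⁅x⁆∣≡1 (f Fin.zero))) (∣image∣≤ g) ⟩
  suc k                           ∎
  where
  open ≤-Reasoning
  g = λ i → f (Fin.suc i)

∈image : ∀ {k n} (f : Fin k → Fin n) i → f i ∈ image f
∈image f Fin.zero    = x∈p∪q⁺ (inj₁ (x∈⁅x⁆ _))
∈image f (Fin.suc i) = x∈p∪q⁺ (inj₂ (∈image _ i))

-- Nothing is promised about positions from `∣ S ∣` on; they become padding when the tuple is longer
-- than the set.
enumeration : ∀ {n} (S : Subset n) →
              Σ[ d ∈ (ℕ → ℕ) ] (∀ {i} → i ∈ S → ∃[ j ] j < ∣ S ∣ × d j ≡ toℕ i)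
enumeration []            = (λ _ → 0) , λ ()
enumeration (outside ∷ S) = let d , f = enumeration S in
  (λ j → suc (d j)) , λ { (there i∈S) → let j , j< , e = f i∈S in j , j< , cong suc e }
enumeration (inside  ∷ S) = let d , f = enumeration S in
  (λ { zero → 0 ; (suc j) → suc (d j) }) ,
  λ { here → 0 , s≤s z≤n , refl
    ; (there i∈S) → let j , j< , e = f i∈S in suc j , s≤s j< , cong suc e }

toArray-toℕ : ∀ {m} (f : Fin m → ℕ) i → toArray f (toℕ i) ≡ f i
toArray-toℕ {m} f i with toℕ i <? m
... | yes i<m = cong f (fromℕ<-toℕ i i<m)
... | no  i≮m = contradiction (toℕ<n i) i≮m

-- Temporal walks, paths and snapshot cuts

module Temporal (G : TemporalGraph) where
  open TemporalGraph G

  time≤lifetime : ∀ e → time e ≤ lifetime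
  time≤lifetime = tabulate⁻ (xs≤max 1 (tabulate time))

  lifetime-least : ∀ {m} → 1 ≤ m → (∀ e → time e ≤ m) → lifetime ≤ m
  lifetime-least 1≤m f = max≤v⁺ 1≤m (tabulate⁺ f)

  1≤lifetime : 1 ≤ lifetime
  1≤lifetime = ⊥≤max 1 (tabulate time)

  times : ∀ {u v} → Walk u v → List ℕ
  times p = map time (edges p)

  relink : ∀ {a b xs} → a ≤ b → Linked _≤_ (b ∷ xs) → Linked _≤_ (a ∷ xs)
  relink a≤b [-]       = [-]
  relink a≤b (b≤c ∷ l) = ≤-trans a≤b b≤c ∷ l

  from-start : ∀ {xs} → Linked _≤_ xs → Linked _≤_ (0 ∷ xs)
  from-start []        = [-]
  from-start [-]       = z≤n ∷ [-]
  from-start (a≤b ∷ l) = z≤n ∷ a≤b ∷ l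

  unlink : ∀ {a xs} → Linked _≤_ (a ∷ xs) → Linked _≤_ xs
  unlink [-]     = []
  unlink (_ ∷ l) = l

  module _ (P : Edge → Set) where

    record Journey (a : ℕ) (u z : Vertex) : Set where
      constructor journey
      field
        route  : Walk u z
        linked : Linked _≤_ (a ∷ times route)
        allP   : All P (edges route)

    record SimpleJourney (a : ℕ) (u z : Vertex) : Set where
      constructor simple
      field
        route  : Walk u z
        linked : Linked _≤_ (a ∷ times route)
        allP   : All P (edges route)
        unique : Unique (vertices route)

    -- The times of the dropped edges lie between `a` and those of the remaining ones, so the
    -- remaining walk may still start at time `a`.
    suffix : ∀ {a u v z} (p : Walk v z) → Linked _≤_ (a ∷ times p) → All P (edges p) →
             Unique (vertices p) → u ∈ₗ vertices p → SimpleJourney a u z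
    suffix stop           l         ps       uq       (here refl)  = simple stop l ps uq
    suffix p@(step _ _ _) l         ps       uq       (here refl)  = simple p l ps uq
    suffix (step e _ p)   (a≤e ∷ l) (_ ∷ ps) (_ ∷ uq) (there u∈p) =
      suffix p (relink a≤e l) ps uq u∈p

    simplify : ∀ {a u z} → Journey a u z → SimpleJourney a u z
    simplify (journey stop l ps) = simple stop l ps ([] ∷ [])
    simplify {u = u} (journey (step e j p) (a≤e ∷ l) (pe ∷ ps))
      with simplify (journey p l ps)
    ... | simple q l′ qs uq with _∈?_ Fin._≟_ u (vertices q)
    ...   | yes u∈q = suffix q (relink a≤e l′) qs uq u∈q
    ...   | no  u∉q = simple (step e j q) (a≤e ∷ l′) (pe ∷ qs) (¬Any⇒All¬ _ u∉q ∷ uq)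

    -- Grows at the far end, as a search does, while `Walk` grows at the front; `prepend` converts.
    -- The time is that of the last edge, and 0 at the start precedes every edge.
    data Arrive (s : Vertex) : Vertex → ℕ → Set where
      start : Arrive s s 0
      hop   : ∀ {u a e w} → Arrive s u a → Joins e u w → a ≤ time e → P e → Arrive s w (time e)

    prepend : ∀ {s u a z} → Arrive s u a → Journey a u z → Journey 0 s z
    prepend start            j                = j
    prepend (hop r e a≤e pe) (journey p l ps) = prepend r (journey (step _ e p) (a≤e ∷ l) (pe ∷ ps))

    arrive⇒path : ∀ {s z a} → Arrive s z a →
                  Σ[ p ∈ TemporalPath s z ] All P (edges (TemporalPath.walk p))
    arrive⇒path r with simplify (prepend r (journey stop [-] []))
    ... | simple p l ps uq = record { walk = p ; temporal = unlink l ; path = uq } , ps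

    module _ (R : Vertex → ℕ → Set)
             (closed : ∀ {u a e w} → R u a → Joins e u w → a ≤ time e → P e → R w (time e)) where

      -- The completeness half of the search, where `R` will be the pairs of vertex and arrival time
      -- that were queued.
      follow : ∀ {u z a} (p : Walk u z) → Linked _≤_ (a ∷ times p) → All P (edges p) →
               R u a → ∃[ b ] R z b
      follow stop         l         ps        r = _ , r
      follow (step e j p) (a≤e ∷ l) (pe ∷ ps) r = follow p l ps (closed r j a≤e pe)

  module _ (h : ℕ) where

    Avoids : (ℕ → ℕ) → Edge → Set
    Avoids d e = ∀ j → j < h → suc (d j) ≢ time e

    Escapes : Vertex → Vertex → (ℕ → ℕ) → Set
    Escapes s z d = Σ[ p ∈ TemporalPath s z ] All (Avoids d) (edges (TemporalPath.walk p))

    Digits : (ℕ → ℕ) → Set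
    Digits d = ∀ {j} → j < h → d j < lifetime

    Escapes-cong : ∀ {s z d d′} → (∀ {j} → j < h → d j ≡ d′ j) → Escapes s z d → Escapes s z d′
    Escapes-cong d≡d′ (p , ps) =
      p , All.map (λ avoids j j<h d′j≡ → avoids j j<h (trans (cong suc (d≡d′ j<h)) d′j≡)) ps

    ¬escapes⇒cut : ∀ {s z d} → Digits d → ¬ Escapes s z d → HasSnapshotCut h s z
    ¬escapes⇒cut {s} {z} {d} d< ¬esc = image f , ∣image∣≤ f , cut
      where
      f : Fin h → Fin lifetime
      f j = fromℕ< (d< (toℕ<n j))

      hits : Edge → Set
      hits e = ∃[ j ] j < h × suc (d j) ≡ time e

      -- Decidability turns the absence of an avoiding path into a hit on each given path.
      hits? : ∀ e → Dec (hits e)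
      hits? e = anyUpTo? (λ j → suc (d j) ≟ time e) h

      active : ∀ {e} → hits e → ActiveIn (image f) e
      active {e} (j , j<h , hit) = f (fromℕ< j<h) , ∈image f _ , (begin
        time e                                   ≡⟨ hit ⟨
        suc (d j)                                ≡⟨ cong (λ k → suc (d k)) (toℕ-fromℕ< j<h) ⟨
        suc (d (toℕ (fromℕ< j<h)))               ≡⟨ cong suc (toℕ-fromℕ< (d< (toℕ<n (fromℕ< j<h)))) ⟨
        suc (toℕ (f (fromℕ< j<h)))               ∎)
        where open ≡-Reasoning

      cut : SnapshotCut s z (image f)
      cut p with Any.any? hits? (edges (TemporalPath.walk p))
      ... | yes hit = Any.map active hit
      ... | no  ¬hit = contradiction
        (p , All.map (λ ¬hit j j<h e → ¬hit (j , j<h , e)) (¬Any⇒All¬ _ ¬hit)) ¬esc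

    escapes⇒¬cut : ∀ {s z} → (∀ d → Digits d → Escapes s z d) → ¬ HasSnapshotCut h s z
    escapes⇒¬cut esc (S , ∣S∣≤h , cut) with enumeration S
    -- The cap makes the padding digits legal and fixes the elements of `S`. Extra timesteps do no
    -- harm: a path that avoids more avoids `S`.
    ... | d , hit with esc (λ j → d j ⊓ pred lifetime) (λ _ → capped _)
      where
      capped : ∀ k → k ⊓ pred lifetime < lifetime
      capped k = ≤-trans (s≤s (m⊓n≤n k _)) (≤-reflexive (suc-pred lifetime ⦃ >-nonZero 1≤lifetime ⦄))
    ...   | p , ps = All¬⇒¬Any (All.map inactive ps) (cut p)
      where
      inactive : ∀ {e} → Avoids (λ j → d j ⊓ pred lifetime) e → ¬ ActiveIn S e
      inactive avoids (i , i∈S , at) with hit i∈S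
      ... | j , j< , dj≡i = avoids j (≤-trans j< ∣S∣≤h) (trans (cong suc (begin
        d j ⊓ pred lifetime   ≡⟨ cong (_⊓ pred lifetime) dj≡i ⟩
        toℕ i ⊓ pred lifetime ≡⟨ m≤n⇒m⊓n≡m (toℕ≤pred[n] i) ⟩
        toℕ i                 ∎)) (sym at))
        where open ≡-Reasoning

  all-times-cut : ∀ {h s z} → s ≢ z → ∣E∣ ≤ h → HasSnapshotCut h s z
  all-times-cut {s = s} {z} s≢z E≤h = image f , ≤-trans (∣image∣≤ f) E≤h , cut
    where
    positive : ∀ e → NonZero (time e)
    positive e = >-nonZero (time-positive e)

    f : Edge → Fin lifetime
    f e = fromℕ< (≤-trans (≤-reflexive (suc-pred (time e) ⦃ positive e ⦄)) (time≤lifetime e))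

    active : ∀ e → ActiveIn (image f) e
    active e = f e , ∈image f e ,
      trans (sym (suc-pred (time e) ⦃ positive e ⦄)) (cong suc (sym (toℕ-fromℕ< _)))

    cut : SnapshotCut s z (image f)
    cut record { walk = stop }       = contradiction refl s≢z
    cut record { walk = step e _ _ } = here (active e)

update-elim : ∀ {A : Set} (P : A → Set) (f : ℕ → A) x y {a} →
     (x ≡ y → P a) → (x ≢ y → P (f y)) → P ((f [ x ↦ a ]) y)
update-elim P f x y new old with x ≟ y
... | yes refl = subst P (sym (updated f x)) (new refl)
... | no  x≢y  = subst P (sym (kept f x≢y)) (old x≢y)

≤suc⁻ : ∀ {k n} → k ≤ suc n → k ≤ n ⊎ k ≡ suc n
≤suc⁻ k≤ with m≤n⇒m<n∨m≡n k≤
... | inj₁ (s≤s k≤n) = inj₁ k≤n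
... | inj₂ k≡        = inj₂ k≡

-- Adjacency lists ordered by time

module Adjacency (G : TemporalGraph) where
  open TemporalGraph G
  open Temporal G

  module _ (src tgt tim : ℕ → ℕ) where

    Stores : ℕ → Edge → Vertex → Vertex → Set
    Stores k e u w = src k ≡ toℕ u × tgt k ≡ toℕ w × tim k ≡ time e

    Listed : ℕ → Edge → Vertex → Vertex → Set
    Listed N e u w = ∃[ k ] 1 ≤ k × k ≤ N × Stores k e u w

  -- Nodes are numbered in the order of time, so that the list of a vertex is
  -- in decreasing order of both number and time.
  record Lists (N : ℕ) (src tgt tim nxt head : ℕ → ℕ) : Set where
    field
      sound    : ∀ {k} → 1 ≤ k → k ≤ N →
                 ∃[ e ] ∃[ u ] ∃[ w ] Joins e u w × Stores src tgt tim k e u w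
      sorted   : ∀ {j k} → 1 ≤ j → j ≤ k → k ≤ N → tim j ≤ tim k
      nxt<     : ∀ {k} → 1 ≤ k → k ≤ N → nxt k < k
      nxt-src  : ∀ {k} → 1 ≤ k → k ≤ N → 1 ≤ nxt k → src (nxt k) ≡ src k
      nxt-max  : ∀ {j k} → 1 ≤ j → j < k → k ≤ N → src j ≡ src k → j ≤ nxt k
      head≤    : ∀ v → head v ≤ N
      head-src : ∀ v → 1 ≤ head v → src (head v) ≡ v
      head-max : ∀ {k} → 1 ≤ k → k ≤ N → k ≤ head (src k)

  module _ {N : ℕ} {a : ℕ} (f : ℕ → ℕ) where

    old : ∀ {k} → k ≤ N → (f [ suc N ↦ a ]) k ≡ f k
    old k≤N = kept f λ e → <⇒≢ (s≤s k≤N) (sym e)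

  still-listed : ∀ {N src tgt tim x y b e u w} → Listed src tgt tim N e u w →
                 Listed (src [ suc N ↦ x ]) (tgt [ suc N ↦ y ]) (tim [ suc N ↦ b ]) (suc N) e u w
  still-listed {src = src} {tgt} {tim} (k , 1≤k , k≤N , us , ws , ts) =
    k , 1≤k , m≤n⇒m≤1+n k≤N ,
    trans (old src k≤N) us , trans (old tgt k≤N) ws , trans (old tim k≤N) ts

  newly-listed : ∀ {N src tgt tim x y b e u w} → x ≡ toℕ u → y ≡ toℕ w → b ≡ time e →
                 Listed (src [ suc N ↦ x ]) (tgt [ suc N ↦ y ]) (tim [ suc N ↦ b ]) (suc N) e u w
  newly-listed {N} {src} {tgt} {tim} x≡ y≡ b≡ = suc N , s≤s z≤n , ≤-refl ,
    trans (updated src _) x≡ , trans (updated tgt _) y≡ , trans (updated tim _) b≡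

  -- The new node is the largest in number and latest in time, so it may go to the front of its
  -- list. The old `head-max` at `x` gives `nxt-max` for it.
  add : ∀ {N src tgt tim nxt head e u w x y b} → Lists N src tgt tim nxt head →
        Joins e u w → x ≡ toℕ u → y ≡ toℕ w → b ≡ time e →
        (∀ {k} → 1 ≤ k → k ≤ N → tim k ≤ b) →
        Lists (suc N) (src [ suc N ↦ x ]) (tgt [ suc N ↦ y ]) (tim [ suc N ↦ b ])
              (nxt [ suc N ↦ head x ]) (head [ x ↦ suc N ])
  add {N} {src} {tgt} {tim} {nxt} {head} {e} {u} {w} {x} {y} {b} L j x≡ y≡ b≡ latest = record
    { sound = sound′ ; sorted = sorted′ ; nxt< = nxt<′ ; nxt-src = nxt-src′ ; nxt-max = nxt-max′
    ; head≤ = head≤′ ; head-src = head-src′ ; head-max = head-max′ }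
    where
    open Lists L
    src′ = src [ suc N ↦ x ]
    tgt′ = tgt [ suc N ↦ y ]
    tim′ = tim [ suc N ↦ b ]
    nxt′ = nxt [ suc N ↦ head x ]
    head′ = head [ x ↦ suc N ]

    sound′ : ∀ {k} → 1 ≤ k → k ≤ suc N →
             ∃[ e ] ∃[ u ] ∃[ w ] Joins e u w × Stores src′ tgt′ tim′ k e u w
    sound′ 1≤k k≤ with ≤suc⁻ k≤
    ... | inj₂ refl = e , u , w , j ,
      trans (updated src _) x≡ , trans (updated tgt _) y≡ , trans (updated tim _) b≡
    ... | inj₁ k≤N = let e , u , w , j , us , ws , ts = sound 1≤k k≤N in
      e , u , w , j , trans (old src k≤N) us , trans (old tgt k≤N) ws , trans (old tim k≤N) ts

    sorted′ : ∀ {j k} → 1 ≤ j → j ≤ k → k ≤ suc N → tim′ j ≤ tim′ k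
    sorted′ 1≤j j≤k k≤ with ≤suc⁻ k≤
    ... | inj₁ k≤N = subst₂ _≤_ (sym (old tim (≤-trans j≤k k≤N))) (sym (old tim k≤N))
      (sorted 1≤j j≤k k≤N)
    ... | inj₂ refl with ≤suc⁻ j≤k
    ...   | inj₁ j≤N  = subst₂ _≤_ (sym (old tim j≤N)) (sym (updated tim _)) (latest 1≤j j≤N)
    ...   | inj₂ refl = ≤-refl

    nxt<′ : ∀ {k} → 1 ≤ k → k ≤ suc N → nxt′ k < k
    nxt<′ 1≤k k≤ with ≤suc⁻ k≤
    ... | inj₁ k≤N  = subst (_< _) (sym (old nxt k≤N)) (nxt< 1≤k k≤N)
    ... | inj₂ refl = subst (_< _) (sym (updated nxt _)) (s≤s (head≤ x))

    nxt-src′ : ∀ {k} → 1 ≤ k → k ≤ suc N → 1 ≤ nxt′ k → src′ (nxt′ k) ≡ src′ k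
    nxt-src′ {k} 1≤k k≤ 1≤nxt with ≤suc⁻ k≤
    ... | inj₁ k≤N = begin
      src′ (nxt′ k) ≡⟨ cong src′ (old nxt k≤N) ⟩
      src′ (nxt k)  ≡⟨ old src (≤-trans (<⇒≤ (nxt< 1≤k k≤N)) k≤N) ⟩
      src (nxt k)   ≡⟨ nxt-src 1≤k k≤N (subst (1 ≤_) (old nxt k≤N) 1≤nxt) ⟩
      src k         ≡⟨ old src k≤N ⟨
      src′ k        ∎
      where open ≡-Reasoning
    ... | inj₂ refl = begin
      src′ (nxt′ k) ≡⟨ cong src′ (updated nxt k) ⟩
      src′ (head x) ≡⟨ old src (head≤ x) ⟩
      src (head x)  ≡⟨ head-src x (subst (1 ≤_) (updated nxt k) 1≤nxt) ⟩
      x             ≡⟨ updated src k ⟨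
      src′ k        ∎
      where open ≡-Reasoning

    nxt-max′ : ∀ {j k} → 1 ≤ j → j < k → k ≤ suc N → src′ j ≡ src′ k → j ≤ nxt′ k
    nxt-max′ {j} 1≤j j<k k≤ same with ≤suc⁻ k≤
    ... | inj₁ k≤N = subst (j ≤_) (sym (old nxt k≤N))
      (nxt-max 1≤j j<k k≤N (trans (sym (old src (≤-trans (<⇒≤ j<k) k≤N))) (trans same (old src k≤N))))
    ... | inj₂ refl = let j≤N = s≤s⁻¹ j<k in
      subst (j ≤_) (sym (updated nxt _))
        (subst (λ v → j ≤ head v) (trans (sym (old src j≤N)) (trans same (updated src _)))
          (head-max 1≤j j≤N))

    head≤′ : ∀ v → head′ v ≤ suc N
    head≤′ v = update-elim (_≤ suc N) head x v (λ _ → ≤-refl) λ _ → m≤n⇒m≤1+n (head≤ v)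

    head-src′ : ∀ v → 1 ≤ head′ v → src′ (head′ v) ≡ v
    head-src′ v = update-elim (λ c → 1 ≤ c → src′ c ≡ v) head x v
      (λ x≡v _ → trans (updated src _) x≡v)
      (λ _ 1≤ → trans (old src (head≤ v)) (head-src v 1≤))

    head-max′ : ∀ {k} → 1 ≤ k → k ≤ suc N → k ≤ head′ (src′ k)
    head-max′ {k} 1≤k k≤ with ≤suc⁻ k≤
    ... | inj₁ k≤N = update-elim (k ≤_) head x (src′ k) (λ _ → k≤)
      λ _ → subst (λ v → k ≤ head v) (sym (old src k≤N)) (head-max 1≤k k≤N)
    ... | inj₂ refl = update-elim (k ≤_) head x (src′ k) (λ _ → ≤-refl)
      λ x≢ → contradiction (sym (updated src k)) x≢

  -- The search and its invariant

  module Searching {s z : Vertex} (ok : ℕ → Set) where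

    Reachable : Vertex → ℕ → Set
    Reachable = Arrive (ok ∘ time) s

    module _ (src cur : ℕ → ℕ) where

      -- Shifted by one: `count` starts at 0, nodes at 1.
      Pending : ℕ → Set
      Pending k = suc k ≤ cur (src (suc k))

      pending? : ∀ k → Dec (Pending k)
      pending? k = suc k ≤? cur (src (suc k))

    Queued : (QV QT : ℕ → ℕ) → ℕ → ℕ → ℕ → Set
    Queued QV QT qt v a = ∃[ j ] j < qt × QV j ≡ v × QT j ≡ a

    -- A node k is still in the list of its source iff k ≤ cur (src k).  The
    -- potential drops in every step: a removed node adds at most one entry to
    -- the queue.
    record Search (n N : ℕ) (src tgt tim cur QV QT : ℕ → ℕ) (qh qt found : ℕ) : Set where
      field
        cur≤      : ∀ v → cur (toℕ {∣V∣} v) ≤ N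
        cur-src   : ∀ v → 1 ≤ cur (toℕ {∣V∣} v) → src (cur (toℕ v)) ≡ toℕ v
        rooted    : Queued QV QT qt (toℕ s) 0
        reached   : ∀ {j} → j < qt → ∃[ v ] QV j ≡ toℕ v × Reachable v (QT j)
        consumed  : ∀ {k} → 1 ≤ k → k ≤ N → cur (src k) < k → ok (tim k) →
                    Queued QV QT qt (tgt k) (tim k)
        processed : ∀ {j k} → j < qh → 1 ≤ k → k ≤ N → src k ≡ QV j → QT j ≤ tim k →
                    cur (src k) < k
        hit       : ∀ {a} → Queued QV QT qt (toℕ z) a → found ≢ 0
        honest    : found ≢ 0 → ∃[ a ] Reachable z a
        potential : 2 * count (pending? src cur) N + qt ≤ n + qh

    module _ {n N : ℕ} {src tgt tim nxt head cur QV QT : ℕ → ℕ} {qh qt found : ℕ}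
             (L : Lists N src tgt tim nxt head)
             where
      open Lists L

      -- What is left of the list is in decreasing order of time. If its front is earlier than the
      -- arrival, or if the list is empty, then every node usable from this entry has been removed.
      advance : Search (suc n) N src tgt tim cur QV QT qh qt found → qh < qt →
                (∀ {k} → 1 ≤ k → k ≤ N → cur (QV qh) ≡ k → tim k < QT qh) →
                Search n N src tgt tim cur QV QT (suc qh) qt found
      advance S qh<qt exhausted = record
        { Search S
        ; processed = processed′
        ; potential = ≤-trans potential (≤-reflexive (sym (+-suc n qh)))
        }
        where
        open Search S
        processed′ : ∀ {j k} → j < suc qh → 1 ≤ k → k ≤ N → src k ≡ QV j → QT j ≤ tim k →
                     cur (src k) < k
        processed′ {j} {k} (s≤s j≤qh) 1≤k k≤N src≡ later with m≤n⇒m<n∨m≡n j≤qh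
        ... | inj₁ j<qh = processed j<qh 1≤k k≤N src≡ later
        ... | inj₂ refl with cur (src k) <? k
        ...   | yes consumed = consumed
        ...   | no  ¬consumed = contradiction
          (≤-trans (s≤s (≤-trans later (sorted 1≤k (≮⇒≥ ¬consumed) cur≤N)))
                   (exhausted (≤-trans 1≤k (≮⇒≥ ¬consumed)) cur≤N (cong cur (sym src≡))))
          (<-irrefl refl)
          where
          cur≤N : cur (src k) ≤ N
          cur≤N = let v , QV≡ , _ = reached qh<qt in
            subst (λ x → cur x ≤ N) (sym (trans src≡ QV≡)) (cur≤ v)

      -- The three conditions on `found′` cover both outcomes of the comparison with `z`, raising
      -- the flag or keeping it. Since `qh ≤ qt`, no processed entry is overwritten.
      push : ∀ {w y b found′} → Search n N src tgt tim cur QV QT qh qt found →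
             y ≡ toℕ w → Reachable w b →
             (y ≡ toℕ z → found′ ≢ 0) → (found ≢ 0 → found′ ≢ 0) →
             (found′ ≢ 0 → found ≢ 0 ⊎ y ≡ toℕ z) → qh ≤ qt →
             Search (suc n) N src tgt tim cur (QV [ qt ↦ y ]) (QT [ qt ↦ b ]) qh (suc qt) found′
      push {w} {y} {b} {found′} S y≡ r new-hit old-hit source qh≤qt = record
        { Search S
        ; rooted = still rooted
        ; reached = reached′
        ; consumed = λ 1≤k k≤N c o → still (consumed 1≤k k≤N c o)
        ; processed = λ {j} {k} j<qh 1≤k k≤N src≡ later →
            processed j<qh 1≤k k≤N (trans src≡ (same QV (≤-trans j<qh qh≤qt)))
              (subst (_≤ tim k) (same QT (≤-trans j<qh qh≤qt)) later)
        ; hit = hit′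
        ; honest = honest′
        ; potential = ≤-trans (≤-reflexive (+-suc _ qt)) (s≤s potential)
        }
        where
        open Search S
        QV′ = QV [ qt ↦ y ]
        QT′ = QT [ qt ↦ b ]

        same : ∀ (f : ℕ → ℕ) {c j} → j < qt → (f [ qt ↦ c ]) j ≡ f j
        same f j<qt = kept f λ e → <⇒≢ j<qt (sym e)

        still : ∀ {v a} → Queued QV QT qt v a → Queued QV′ QT′ (suc qt) v a
        still (j , j<qt , v≡ , a≡) =
          j , m<n⇒m<1+n j<qt , trans (same QV j<qt) v≡ , trans (same QT j<qt) a≡

        reached′ : ∀ {j} → j < suc qt → ∃[ v ] QV′ j ≡ toℕ v × Reachable v (QT′ j)
        reached′ (s≤s j≤qt) with m≤n⇒m<n∨m≡n j≤qt
        ... | inj₁ j<qt = let v , v≡ , r = reached j<qt in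
          v , trans (same QV j<qt) v≡ , subst (Reachable v) (sym (same QT j<qt)) r
        ... | inj₂ refl = w , trans (updated QV qt) y≡ , subst (Reachable w) (sym (updated QT qt)) r

        hit′ : ∀ {a} → Queued QV′ QT′ (suc qt) (toℕ z) a → found′ ≢ 0
        hit′ (j , s≤s j≤qt , v≡ , a≡) with m≤n⇒m<n∨m≡n j≤qt
        ... | inj₁ j<qt = old-hit (hit (j , j<qt , trans (sym (same QV j<qt)) v≡ , refl))
        ... | inj₂ refl = new-hit (trans (sym (updated QV qt)) v≡)

        honest′ : found′ ≢ 0 → ∃[ a ] Reachable z a
        honest′ f with source f
        ... | inj₁ f′  = honest f′
        ... | inj₂ y≡z = b , subst (λ v → Reachable v b) (toℕ-injective (trans (sym y≡) y≡z)) r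

      -- A removed node frees 2 units of potential: one pays for the step, the other for the entry
      -- that `push` has added. Since lists only shrink, `processed` survives.
      pop : ∀ {x v : ℕ} {u : Vertex} → Search (2 + n) N src tgt tim cur QV QT qh qt found →
            v ≡ toℕ u → x ≡ cur v → 1 ≤ x →
            (ok (tim x) → Queued QV QT qt (tgt x) (tim x)) →
            Search n N src tgt tim (cur [ v ↦ nxt x ]) QV QT qh qt found
      pop {suc x′} {v} {u} S v≡ x≡ 1≤x handled = record
        { Search S
        ; cur≤ = λ v′ → update-elim (_≤ N) cur v (toℕ v′)
            (λ _ → ≤-trans (<⇒≤ (nxt< 1≤x x≤N)) x≤N) (λ _ → cur≤ v′)
        ; cur-src = λ v′ → update-elim (λ c → 1 ≤ c → src c ≡ toℕ v′) cur v (toℕ v′)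
            (λ e 1≤ → trans (nxt-src 1≤x x≤N 1≤) (trans srcx e)) (λ _ → cur-src v′)
        ; consumed = λ {k} 1≤k k≤N → update-elim
            (λ c → c < k → ok (tim k) → Queued QV QT qt (tgt k) (tim k)) cur v (src k) (λ e → consumed′ 1≤k k≤N (sym e)) (λ _ → consumed 1≤k k≤N)
        ; processed = λ {j} {k} j<qh 1≤k k≤N src≡ later →
            ≤-trans (s≤s (smaller (src k))) (processed j<qh 1≤k k≤N src≡ later)
        ; potential = +-cancelˡ-≤ 2 _ _ (begin
            2 + (2 * count (pending? src cur′) N + qt) ≡⟨ +-assoc 2 (2 * count (pending? src cur′) N) qt ⟨
            2 + 2 * count (pending? src cur′) N + qt   ≡⟨ cong (_+ qt) (*-suc 2 _) ⟨
            2 * suc (count (pending? src cur′) N) + qt ≤⟨ +-monoˡ-≤ qt (*-monoʳ-≤ 2 fewer) ⟩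
            2 * count (pending? src cur) N + qt        ≤⟨ potential ⟩
            2 + n + qh                                 ∎)
        }
        where
        open Search S
        open ≤-Reasoning
        x = suc x′
        cur′ = cur [ v ↦ nxt x ]

        x≤N : x ≤ N
        x≤N = subst (_≤ N) (sym (trans x≡ (cong cur v≡))) (cur≤ u)

        srcx : src x ≡ v
        srcx = trans (cong src (trans x≡ (cong cur v≡)))
          (trans (cur-src u (subst (1 ≤_) (trans x≡ (cong cur v≡)) 1≤x)) (sym v≡))

        smaller : ∀ v′ → cur′ v′ ≤ cur v′
        smaller v′ = update-elim (_≤ cur v′) cur v v′
          (λ e → ≤-trans (<⇒≤ (nxt< 1≤x x≤N)) (≤-reflexive (trans x≡ (cong cur e))))
          (λ _ → ≤-refl)

        fewer : count (pending? src cur′) N < count (pending? src cur) N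
        fewer = count-strict (pending? src cur′) (pending? src cur) {x′} N
          (λ _ p → ≤-trans p (smaller _)) x≤N
          (≤-reflexive (trans x≡ (cong cur (sym srcx))))
          (λ p → <⇒≱ (nxt< 1≤x x≤N) (subst (x ≤_)
            (trans (cong cur′ srcx) (updated cur v)) p))

        consumed′ : ∀ {k} → 1 ≤ k → k ≤ N → src k ≡ v → nxt x < k → ok (tim k) →
                    Queued QV QT qt (tgt k) (tim k)
        consumed′ {k} 1≤k k≤N src≡v nxt<k o with <-cmp k x
        ... | tri< k<x _ _ = contradiction (nxt-max 1≤k k<x x≤N (trans src≡v (sym srcx))) (<⇒≱ nxt<k)
        ... | tri≈ _ refl _ = handled o
        ... | tri> _ _ x<k = consumed 1≤k k≤N
          (subst (_< k) (trans x≡ (cong cur (sym src≡v))) x<k) o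

    -- For a node of a deleted timestep, which is removed without a queue entry: the second unit is
    -- given up.
    slacken : ∀ {n N src tgt tim cur QV QT qh qt found} →
              Search n N src tgt tim cur QV QT qh qt found →
              Search (suc n) N src tgt tim cur QV QT qh qt found
    slacken S = record { Search S ; potential = m≤n⇒m≤1+n (Search.potential S) }

    module _ {N : ℕ} {src tgt tim nxt head cur QV QT : ℕ → ℕ} {found : ℕ}
             (L : Lists N src tgt tim nxt head)
             where
      open Lists L

      -- The fuel is 2 for each node and 1 for the entry of `s`. The flag may start at 0 because
      -- that entry is not `z`.
      begin-search : s ≢ z → (∀ v → cur (toℕ {∣V∣} v) ≡ head (toℕ v)) →
                     QV 0 ≡ toℕ s → QT 0 ≡ 0 → found ≡ 0 →
                     Search (suc (2 * N)) N src tgt tim cur QV QT 0 1 found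
      begin-search s≢z copied QV≡ QT≡ f≡ = record
        { cur≤ = λ v → subst (_≤ N) (sym (copied v)) (head≤ _)
        ; cur-src = λ v 1≤ → trans (cong src (copied v)) (head-src _ (subst (1 ≤_) (copied v) 1≤))
        ; rooted = 0 , s≤s z≤n , QV≡ , QT≡
        ; reached = λ { (s≤s z≤n) → s , QV≡ , subst (Reachable s) (sym QT≡) start }
        ; consumed = λ {k} 1≤k k≤N c → contradiction (head-max 1≤k k≤N)
            (<⇒≱ (subst (_< k) (copied′ 1≤k k≤N) c))
        ; processed = λ ()
        ; hit = λ { (zero , _ , v≡ , _) → contradiction (toℕ-injective (trans (sym QV≡) v≡)) s≢z
                  ; (suc _ , s≤s () , _) }
        ; honest = λ f → contradiction f≡ f
        ; potential = ≤-trans (+-monoˡ-≤ 1 (*-monoʳ-≤ 2 (count≤ (pending? src cur) N)))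
            (≤-reflexive (trans (+-comm _ 1) (sym (+-identityʳ _))))
        }
        where
        copied′ : ∀ {k} → 1 ≤ k → k ≤ N → cur (src k) ≡ head (src k)
        copied′ 1≤k k≤N = let _ , u , _ , _ , us , _ = sound 1≤k k≤N in
          trans (cong cur us) (trans (copied u) (cong head (sym us)))

    module _ {n N : ℕ} {src tgt tim cur QV QT : ℕ → ℕ} {qh qt found : ℕ}
             (complete : ∀ {e u w} → Joins e u w → Listed src tgt tim N e u w)
             (S : Search n N src tgt tim cur QV QT qh qt found) (qt≤qh : qt ≤ qh)
             where
      open Search S

      reached⇒path : found ≢ 0 →
        Σ[ p ∈ TemporalPath s z ] All (ok ∘ time) (edges (TemporalPath.walk p))
      reached⇒path f = let _ , r = honest f in arrive⇒path (ok ∘ time) r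

      -- Once the queue is exhausted, its entries are closed under permitted hops: `processed` says
      -- that the node of the hop is removed, and `consumed` that its target was queued at that
      -- time.
      path⇒reached : (p : TemporalPath s z) → All (ok ∘ time) (edges (TemporalPath.walk p)) → found ≢ 0
      path⇒reached p oks =
        let _ , q = follow (ok ∘ time) (λ u a → Queued QV QT qt (toℕ u) a) closed
                      (TemporalPath.walk p) (from-start (TemporalPath.temporal p)) oks rooted
        in hit q
        where
        closed : ∀ {u a e w} → Queued QV QT qt (toℕ u) a → Joins e u w → a ≤ time e → ok (time e) →
                 Queued QV QT qt (toℕ w) (time e)
        closed (j , j<qt , u≡ , a≡) joins a≤e o with complete joins
        ... | k , 1≤k , k≤N , us , ws , ts = subst₂ (Queued QV QT qt) ws ts
          (consumed 1≤k k≤N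
            (processed (≤-trans j<qt qt≤qh) 1≤k k≤N (trans us (sym u≡))
              (subst₂ _≤_ (sym a≡) (sym ts) a≤e))
            (subst ok (sym ts) o))

-- The program and its memory layout

-- Registers, beyond those of the input: 5 lifetime, 6 loop index, 7 timestep,
-- 8 number of list nodes, 9 current mark, 10 and 11 front and end of the
-- queue, 12 whether z was reached, 13 carry, 14 whether to stop, 15–17 scratch.
-- Arrays, beyond those of the input: 3–6 source, target, time and successor of
-- a list node, where nodes are numbered from 1 and 0 ends a list; 7 heads of
-- the lists; 8 what remains of them in the search; 9 and 10 vertex and arrival
-- time of a queue entry; 11 the tuple, with digit i standing for timestep
-- 1 + i; 12 the mark of a timestep, which is deleted if its mark is current.

findLifetime : Program
findLifetime =
  set 5 (lit 1) ⨾
  for 6 (reg 1) (cond (lt (reg 5) (arr 2 (reg 6))) (set 5 (arr 2 (reg 6))) skip)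

addNode : ℕ → ℕ → Program
addNode a b =
  set 8 (inc (reg 8)) ⨾
  set 15 (arr a (reg 6)) ⨾
  set 16 (arr b (reg 6)) ⨾
  set 17 (arr 7 (reg 15)) ⨾
  store 3 (reg 8) (reg 15) ⨾
  store 4 (reg 8) (reg 16) ⨾
  store 5 (reg 8) (reg 7) ⨾
  store 6 (reg 8) (reg 17) ⨾
  store 7 (reg 15) (reg 8)

listEdge : Program
listEdge = cond (eq (arr 2 (reg 6)) (reg 7)) (addNode 0 1 ⨾ addNode 1 0) skip

-- Scanning from timestep 0, at which no edge is active, makes lifetime + 1 scans.
buildLists : Program
buildLists = for 7 (inc (reg 5)) (for 6 (reg 1) listEdge)

-- No mark exceeds register 9, so incrementing it makes all earlier marks stale at once.
markDigits : Program
markDigits = set 9 (inc (reg 9)) ⨾ for 6 (reg 2) (store 12 (inc (arr 11 (reg 6))) (reg 9))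

copyHeads : Program
copyHeads = for 6 (reg 0) (store 8 (reg 6) (arr 7 (reg 6)))

enqueueSource : Program
enqueueSource =
  set 10 (lit 0) ⨾ set 11 (lit 1) ⨾ set 12 (lit 0) ⨾
  store 9 (lit 0) (reg 3) ⨾ store 10 (lit 0) (lit 0)

enqueueTarget : Program
enqueueTarget =
  store 9 (reg 11) (arr 4 (reg 15)) ⨾
  store 10 (reg 11) (arr 5 (reg 15)) ⨾
  set 11 (inc (reg 11)) ⨾
  cond (eq (arr 4 (reg 15)) (reg 4)) (set 12 (lit 1)) skip

-- Each step either moves the front of the queue or removes one node. Nodes of deleted timesteps are
-- removed too, as no arrival can use them.
searchStep : Program
searchStep =
  set 16 (arr 9 (reg 10)) ⨾
  set 15 (arr 8 (reg 16)) ⨾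
  cond (eq (reg 15) (lit 0))
    (set 10 (inc (reg 10)))
    (cond (lt (arr 5 (reg 15)) (arr 10 (reg 10)))
      (set 10 (inc (reg 10)))
      (store 8 (reg 16) (arr 6 (reg 15)) ⨾
       cond (eq (arr 12 (arr 5 (reg 15))) (reg 9)) skip enqueueTarget))

search : Program
search = while (lt (reg 10) (reg 11)) searchStep

carryDigit : Program
carryDigit =
  cond (eq (reg 13) (lit 1))
    (cond (lt (inc (arr 11 (reg 6))) (reg 5))
      (store 11 (reg 6) (inc (arr 11 (reg 6))) ⨾ set 13 (lit 0))
      (store 11 (reg 6) (lit 0)))
    skip

-- Visits all digits even after the carry has died out. A carry left at the end shows that the tuple
-- was the last one.
successor : Program
successor = set 13 (lit 1) ⨾ for 6 (reg 2) carryDigit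

tryDigits : Program
tryDigits =
  markDigits ⨾ copyHeads ⨾ enqueueSource ⨾ search ⨾
  cond (eq (reg 12) (lit 0))
    (set 14 (lit 1))
    (successor ⨾ cond (eq (reg 13) (lit 0)) skip (set 14 (lit 1)))

program : Program
program =
  cond (lt (reg 2) (reg 1))
    (findLifetime ⨾ buildLists ⨾ while (eq (reg 14) (lit 0)) tryDigits ⨾
     cond (eq (reg 12) (lit 0)) (set 0 (lit 1)) (set 0 (lit 0)))
    (set 0 (lit 1))

-- Costs per unit of |V| + |E|, with summands nested as in the proofs. The 5 in `searchTime` comes
-- from 1 + 2 · 2|E| steps: 2 for each of at most 2|E| nodes, and 1 for the entry of `s`.
edgeLoopTime markTime copyTime searchTime successorTime decideTime roundTime : ℕ
edgeLoopTime  = 5 + (3 + (bound listEdge + 3))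
markTime      = 8 + 11
copyTime      = 5 + 10
searchTime    = 3 + 5 * (3 + bound searchStep)
successorTime = 7 + (6 + bound carryDigit)
decideTime    = 3 + (2 + (successorTime + 6))
roundTime     = markTime + (copyTime + (12 + (searchTime + decideTime)))

-- Costs per unit of lifetime ^ h · (|V| + |E|). The factors 2 are that of `bilinear`.
lifetimeTime buildTime enumerateTime totalTime : ℕ
lifetimeTime  = 21
buildTime     = 6 + 2 * (4 + (edgeLoopTime + 3))
enumerateTime = 3 + 2 * (3 + roundTime)
totalTime     = 3 + ((lifetimeTime + (buildTime + (enumerateTime + 7))) + 2)

linear : ∀ {X L} → 1 ≤ X → L ≤ X → ∀ a b → a + L * b ≤ X * (a + b)
linear {X} {L} 1≤X L≤X a b = begin
  a + L * b     ≡⟨ cong (_+ L * b) (*-identityˡ a) ⟨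
  1 * a + L * b ≤⟨ +-mono-≤ (*-monoˡ-≤ a 1≤X) (*-monoˡ-≤ b L≤X) ⟩
  X * a + X * b ≡⟨ *-distribˡ-+ X a b ⟨
  X * (a + b)   ∎
  where open ≤-Reasoning

constant : ∀ {X} → 1 ≤ X → ∀ a → a ≤ X * a
constant {X} 1≤X a = ≤-trans (≤-reflexive (sym (*-identityˡ a))) (*-monoˡ-≤ a 1≤X)

-- For nested loops: `L` rounds of cost at most `b` + `Y` · `k`. The slack of 2 in `L` makes room
-- for the extra scan in `buildLists`.
bilinear : ∀ {M Y L} → 1 ≤ M * Y → L ≤ M * 2 → ∀ a b {c k} → c ≤ Y * k → 1 ≤ Y →
           a + L * (b + c) ≤ M * Y * (a + 2 * (b + k))
bilinear {M} {Y} {L} 1≤X L≤2M a b {c} {k} c≤ 1≤Y = begin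
  a + L * (b + c)                       ≤⟨ +-mono-≤ (constant 1≤X a) (*-mono-≤ L≤2M inner) ⟩
  M * Y * a + M * 2 * (Y * (b + k))     ≡⟨ cong (M * Y * a +_) ([m*n]*[o*p]≡[m*o]*[n*p] M 2 Y (b + k)) ⟩
  M * Y * a + M * Y * (2 * (b + k))     ≡⟨ *-distribˡ-+ (M * Y) a _ ⟨
  M * Y * (a + 2 * (b + k))             ∎
  where
  open ≤-Reasoning
  inner : b + c ≤ Y * (b + k)
  inner = ≤-trans (+-mono-≤ (constant 1≤Y b) c≤) (≤-reflexive (sym (*-distribˡ-+ Y b k)))

both : ∀ X {a b c d} → a ≤ X * c → b ≤ X * d → a + b ≤ X * (c + d)
both X {c = c} {d} a≤ b≤ = ≤-trans (+-mono-≤ a≤ b≤) (≤-reflexive (sym (*-distribˡ-+ X c d)))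

-- Correctness: the input and its lifetime

module Deciding (G : TemporalGraph) (h : ℕ) (1≤h : 1 ≤ h)
                (s z : TemporalGraph.Vertex G) (s≢z : s ≢ z) where
  open TemporalGraph G
  open Temporal G
  open Adjacency G

  -- Takes the registers and arrays it reads rather than the state, so that writes elsewhere leave
  -- it definitionally unchanged. The other invariants have this form for the same reason.
  record GivenBy (V E k a b : ℕ) (ends₁ ends₂ T : ℕ → ℕ) : Set where
    field
      vertices≡ : V ≡ ∣V∣
      edges≡    : E ≡ ∣E∣
      h≡        : k ≡ h
      s≡        : a ≡ toℕ s
      z≡        : b ≡ toℕ z
      ends₁≡    : ∀ e → ends₁ (toℕ e) ≡ toℕ (proj₁ (ends e))
      ends₂≡    : ∀ e → ends₂ (toℕ e) ≡ toℕ (proj₂ (ends e))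
      time≡     : ∀ e → T (toℕ e) ≡ time e

  Given : State → Set
  Given σ = GivenBy (register σ 0) (register σ 1) (register σ 2) (register σ 3) (register σ 4)
                    (array σ 0) (array σ 1) (array σ 2)

  Blank : State → Set
  Blank σ = (∀ b → array σ 12 b ≤ register σ 9) × (∀ j → array σ 11 j ≡ 0) × register σ 14 ≡ 0

  Empty : State → Set
  Empty σ = (∀ v → array σ 7 v ≡ 0) × register σ 8 ≡ 0

  Below : (ℕ → ℕ) → ℕ → ℕ → Set
  Below T i m = 1 ≤ m × m ≤ lifetime × (∀ e → toℕ {∣E∣} e < i → T (toℕ e) ≤ m)

  findLifetime-correct : ∀ {X σ} → 1 ≤ X → ∣E∣ ≤ X → Given σ × Blank σ × Empty σ →
    Halts findLifetime σ (λ σ′ → (Given σ′ × Blank σ′ × Empty σ′) × register σ′ 5 ≡ lifetime)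
          (X * lifetimeTime)
  findLifetime-correct {X} 1≤X E≤X blank = relax (linear 1≤X E≤X 7 14)
    (straight (set 5 (lit 1)) {λ σ → Inv (setRegister 6 0 σ)}
       (λ { _ refl → blank , ≤-refl , 1≤lifetime , λ _ () })
     andThen λ _ i → consequence finish
       (loop 6 (reg 1) Inv (λ _ ((g , _) , _) → GivenBy.edges≡ g) body i))
    where
    Inv : State → Set
    Inv σ = (Given σ × Blank σ × Empty σ) × Below (array σ 2) (register σ 6) (register σ 5)

    body : ∀ σ → Inv σ → register σ 6 < ∣E∣ →
           Halts (cond (lt (reg 5) (arr 2 (reg 6))) (set 5 (arr 2 (reg 6))) skip) σ
             (λ σ′ → register σ′ 6 ≡ register σ 6 × Inv (increment 6 σ′)) 8
    body σ (i@(g , _) , 1≤m , m≤ , below) i<E =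
      straight (cond (lt (reg 5) (arr 2 (reg 6))) (set 5 (arr 2 (reg 6))) skip)
        ( (λ { m<t _ refl → refl , i , ≤-trans 1≤m (<⇒≤ m<t)
            , subst (_≤ lifetime) current (time≤lifetime e)
            , λ e′ e′≤ → extend e′≤ ≤-refl λ e′< → ≤-trans (below e′ e′<) (<⇒≤ m<t) })
        , (λ m≮t → refl , i , 1≤m , m≤ , λ e′ e′≤ → extend e′≤ (≮⇒≥ m≮t) (below e′)))
      where
      e : Edge
      e = fromℕ< i<E

      current : time e ≡ array σ 2 (register σ 6)
      current = trans (sym (GivenBy.time≡ g e)) (cong (array σ 2) (toℕ-fromℕ< i<E))

      extend : ∀ {e′ m} → e′ < suc (register σ 6) → array σ 2 (register σ 6) ≤ m →
               (e′ < register σ 6 → array σ 2 e′ ≤ m) → array σ 2 e′ ≤ m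
      extend (s≤s e′≤i) now before with m≤n⇒m<n∨m≡n e′≤i
      ... | inj₁ e′<i = before e′<i
      ... | inj₂ refl = now

    finish : ∀ σ → Inv σ × register σ 6 ≡ ∣E∣ →
             (Given σ × Blank σ × Empty σ) × register σ 5 ≡ lifetime
    finish σ ((i@(g , _) , 1≤m , m≤ , below) , end) = i , ≤-antisym m≤ (lifetime-least 1≤m λ e →
      subst (_≤ register σ 5) (GivenBy.time≡ g e) (below e (subst (toℕ e <_) (sym end) (toℕ<n e))))

  -- Correctness: building the lists

  -- Edges not yet listed when the scan for timestep t has come to edge i.
  module _ (T : ℕ → ℕ) (t i : ℕ) where

    Waiting : ℕ → Set
    Waiting k = t < T k ⊎ t ≡ T k × i ≤ k

    waiting? : ∀ k → Dec (Waiting k)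
    waiting? k = (t <? T k) ⊎-dec ((t ≟ T k) ×-dec (i ≤? k))

  -- `size` reserves two nodes for every waiting edge, which yields at most 2|E| nodes in the end.
  -- `latest` is what `add` demands of a new node.
  record Building (T : ℕ → ℕ) (t i N : ℕ) (src tgt tim nxt head : ℕ → ℕ) : Set where
    field
      lists  : Lists N src tgt tim nxt head
      latest : ∀ {k} → 1 ≤ k → k ≤ N → tim k ≤ t
      listed : ∀ {e u w} → T (toℕ e) < t ⊎ (T (toℕ e) ≡ t × toℕ e < i) → Joins e u w →
               Listed src tgt tim N e u w
      size   : N + 2 * count (waiting? T t i) ∣E∣ ≤ 2 * ∣E∣

  build-start : ∀ {T N src tgt tim nxt head} → N ≡ 0 → (∀ v → head v ≡ 0) →
                Building T 0 0 N src tgt tim nxt head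
  build-start {T} {head = head} refl empty = record
    { lists = record
      { sound    = λ 1≤k k≤0 → contradiction (≤-trans 1≤k k≤0) (λ ())
      ; sorted   = λ 1≤j j≤k k≤0 → contradiction (≤-trans 1≤j (≤-trans j≤k k≤0)) (λ ())
      ; nxt<     = λ 1≤k k≤0 → contradiction (≤-trans 1≤k k≤0) (λ ())
      ; nxt-src  = λ 1≤k k≤0 → contradiction (≤-trans 1≤k k≤0) (λ ())
      ; nxt-max  = λ 1≤j j<k k≤0 → contradiction (≤-trans 1≤j (≤-trans (<⇒≤ j<k) k≤0)) (λ ())
      ; head≤    = λ v → ≤-reflexive (empty v)
      ; head-src = λ v 1≤ → contradiction (subst (1 ≤_) (empty v) 1≤) (λ ())
      ; head-max = λ 1≤k k≤0 → contradiction (≤-trans 1≤k k≤0) (λ ())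
      }
    ; latest = λ 1≤k k≤0 → contradiction (≤-trans 1≤k k≤0) (λ ())
    ; listed = λ { (inj₁ ()) ; (inj₂ (_ , ())) }
    ; size   = *-monoʳ-≤ 2 (count≤ (waiting? T 0 0) ∣E∣)
    }

  module _ {T : ℕ → ℕ} {t i N : ℕ} {src tgt tim nxt head : ℕ → ℕ}
           (B : Building T t i N src tgt tim nxt head) where
    open Building B

    build-skip : T i ≢ t → Building T t (suc i) N src tgt tim nxt head
    build-skip Ti≢t = record
      { Building B
      ; listed = λ where
          (inj₁ earlier) → listed (inj₁ earlier)
          (inj₂ (now , s≤s e≤i)) → listed (inj₂ (now , ≤∧≢⇒< e≤i λ e≡i →
            Ti≢t (trans (cong T (sym e≡i)) now)))
      ; size = ≤-trans (+-monoʳ-≤ N (*-monoʳ-≤ 2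
          (count-mono (waiting? T t (suc i)) (waiting? T t i) ∣E∣ weaken))) size
      }
      where
      weaken : ∀ {k} → k < ∣E∣ → Waiting T t (suc i) k → Waiting T t i k
      weaken _ (inj₁ later)     = inj₁ later
      weaken _ (inj₂ (now , i<)) = inj₂ (now , <⇒≤ i<)

    build-next : i ≡ ∣E∣ → Building T (suc t) 0 N src tgt tim nxt head
    build-next refl = record
      { Building B
      ; latest = λ 1≤k k≤N → m≤n⇒m≤1+n (latest 1≤k k≤N)
      ; listed = λ { {e} (inj₁ (s≤s T≤t)) → listed (map₂ (_, toℕ<n e) (m≤n⇒m<n∨m≡n T≤t))
                   ; (inj₂ (_ , ())) }
      ; size = ≤-trans (+-monoʳ-≤ N (*-monoʳ-≤ 2
          (count-mono (waiting? T (suc t) 0) (waiting? T t i) ∣E∣ weaken))) size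
      }
      where
      weaken : ∀ {k} → k < ∣E∣ → Waiting T (suc t) 0 k → Waiting T t i k
      weaken _ (inj₁ later)     = inj₁ (<⇒≤ later)
      weaken _ (inj₂ (now , _)) = inj₁ (≤-reflexive now)

    -- From `n ≡ suc N` on, the equations are those that `wp` produces for the assignments of the
    -- two `addNode`s. The second reads the heads after the first has changed them.
    build-add : ∀ {e x y n x′ y′ p n′ x″ y″ p′} → i ≡ toℕ e → T (toℕ e) ≡ time e → T i ≡ t →
                x ≡ toℕ (proj₁ (ends e)) → y ≡ toℕ (proj₂ (ends e)) →
                n ≡ suc N → x′ ≡ x → y′ ≡ y → p ≡ head x′ →
                n′ ≡ suc n → y″ ≡ y → x″ ≡ x → p′ ≡ (head [ x′ ↦ n ]) y″ →
                Building T t (suc i) n′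
                  (src [ n ↦ x′ ] [ n′ ↦ y″ ]) (tgt [ n ↦ y′ ] [ n′ ↦ x″ ])
                  (tim [ n ↦ t ] [ n′ ↦ t ]) (nxt [ n ↦ p ] [ n′ ↦ p′ ])
                  (head [ x′ ↦ n ] [ y″ ↦ n′ ])
    build-add {e} {x} {y} refl T≡ now x≡ y≡ refl refl refl refl refl refl refl refl = record
      { lists  = add (add lists (inj₁ refl) x≡ y≡ t≡ latest) (inj₂ refl) y≡ x≡ t≡ (latest′ tim latest)
      ; latest = latest′ (tim [ suc N ↦ t ]) (latest′ tim latest)
      ; listed = listed′
      ; size   = size′
      }
      where
      t≡ : t ≡ time e
      t≡ = trans (sym now) T≡

      latest′ : ∀ {n} (f : ℕ → ℕ) → (∀ {k} → 1 ≤ k → k ≤ n → f k ≤ t) →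
                ∀ {k} → 1 ≤ k → k ≤ suc n → (f [ suc n ↦ t ]) k ≤ t
      latest′ {n} f f≤ {k} 1≤k k≤ = update-elim (_≤ t) f (suc n) k (λ _ → ≤-refl)
        λ n≢ → f≤ 1≤k (s≤s⁻¹ (≤∧≢⇒< k≤ (λ k≡ → n≢ (sym k≡))))

      listed′ : ∀ {e′ u w} → T (toℕ e′) < t ⊎ (T (toℕ e′) ≡ t × toℕ e′ < suc i) →
                Joins e′ u w → Listed _ _ _ _ e′ u w
      listed′ (inj₁ earlier) j = still-listed (still-listed (listed (inj₁ earlier) j))
      listed′ (inj₂ (now′ , s≤s e′≤)) j with m≤n⇒m<n∨m≡n e′≤
      ... | inj₁ e′< = still-listed (still-listed (listed (inj₂ (now′ , e′<)) j))
      ... | inj₂ same with toℕ-injective same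
      ...   | refl with j
      ...     | inj₁ refl = still-listed (newly-listed x≡ y≡ t≡)
      ...     | inj₂ refl = newly-listed y≡ x≡ t≡

      fewer : count (waiting? T t (suc i)) ∣E∣ < count (waiting? T t i) ∣E∣
      fewer = count-strict (waiting? T t (suc i)) (waiting? T t i) {i} ∣E∣
        (λ { _ (inj₁ later) → inj₁ later ; _ (inj₂ (now , i<)) → inj₂ (now , <⇒≤ i<) })
        (toℕ<n e) (inj₂ (sym now , ≤-refl))
        λ { (inj₁ later) → <⇒≢ later (sym now) ; (inj₂ (_ , i<i)) → <-irrefl refl i<i }

      size′ : 2 + N + 2 * count (waiting? T t (suc i)) ∣E∣ ≤ 2 * ∣E∣
      size′ = begin
        2 + N + 2 * c       ≡⟨ cong (_+ 2 * c) (+-comm 2 N) ⟩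
        N + 2 + 2 * c       ≡⟨ +-assoc N 2 (2 * c) ⟩
        N + (2 + 2 * c)     ≡⟨ cong (N +_) (*-suc 2 c) ⟨
        N + 2 * suc c       ≤⟨ +-monoʳ-≤ N (*-monoʳ-≤ 2 fewer) ⟩
        N + 2 * count (waiting? T t i) ∣E∣ ≤⟨ size ⟩
        2 * ∣E∣             ∎
        where
        open ≤-Reasoning
        c = count (waiting? T t (suc i)) ∣E∣

  record Built (N : ℕ) (src tgt tim nxt head : ℕ → ℕ) : Set where
    field
      lists    : Lists N src tgt tim nxt head
      complete : ∀ {e u w} → Joins e u w → Listed src tgt tim N e u w
      size     : N ≤ 2 * ∣E∣

  Static : State → Set
  Static σ = Given σ × register σ 5 ≡ lifetime ×
    Built (register σ 8) (array σ 3) (array σ 4) (array σ 5) (array σ 6) (array σ 7)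

  buildLists-correct : ∀ {M Y σ} → 1 ≤ M * Y → 1 ≤ Y → ∣E∣ ≤ Y → lifetime < M * 2 →
    (Given σ × Blank σ × Empty σ) × register σ 5 ≡ lifetime →
    Halts buildLists σ (λ σ′ → Static σ′ × Blank σ′) (M * Y * buildTime)
  buildLists-correct {M} {Y} 1≤X 1≤Y E≤Y L≤ ((g , b , empty , none) , τ≡) =
    relax (bilinear {M} {Y} 1≤X L≤ 6 4 (both Y ≤-refl (constant 1≤Y 3)) 1≤Y)
      (consequence finish (loop 7 (inc (reg 5)) Outer (λ _ ((_ , τ≡ , _) , _) → cong suc τ≡) outer
        ((g , τ≡ , b) , build-start none empty)))
    where
    Rest : State → Set
    Rest σ = Given σ × register σ 5 ≡ lifetime × Blank σ

    At : ℕ → ℕ → State → Set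
    At t i σ = Building (array σ 2) t i (register σ 8)
                 (array σ 3) (array σ 4) (array σ 5) (array σ 6) (array σ 7)

    Outer : State → Set
    Outer σ = Rest σ × At (register σ 7) 0 σ

    Inner : ℕ → State → Set
    Inner t σ = Rest σ × register σ 7 ≡ t × At (register σ 7) (register σ 6) σ

    inner : ∀ {t} σ → Inner t σ → register σ 6 < ∣E∣ →
            Halts listEdge σ (λ σ′ → register σ′ 6 ≡ register σ 6 × Inner t (increment 6 σ′))
                  (bound listEdge)
    inner σ (r@(g , _) , t≡ , B) i<E = straight listEdge
      ( (λ now n n≡ x x≡ y y≡ p p≡ n′ n′≡ y′ y′≡ x′ x′≡ p′ p′≡ → refl , r , t≡ ,
          build-add B {fromℕ< i<E} (sym (toℕ-fromℕ< i<E)) (time≡ _) now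
          (trans (cong (array σ 0) (sym (toℕ-fromℕ< i<E))) (ends₁≡ _))
          (trans (cong (array σ 1) (sym (toℕ-fromℕ< i<E))) (ends₂≡ _))
          n≡ x≡ y≡ p≡ n′≡ y′≡ x′≡ p′≡)
      , (λ later → refl , r , t≡ , build-skip B later))
      where open GivenBy g

    outer : ∀ σ → Outer σ → register σ 7 < suc lifetime →
            Halts (for 6 (reg 1) listEdge) σ
              (λ σ′ → register σ′ 7 ≡ register σ 7 × Outer (increment 7 σ′)) (Y * edgeLoopTime)
    outer σ (r , B) _ = relax (linear 1≤Y E≤Y 5 (3 + (bound listEdge + 3)))
      (consequence (λ σ′ ((r , t≡ , B) , end) → t≡ , r , build-next B end)
        (loop 6 (reg 1) (Inner (register σ 7)) (λ _ ((g , _) , _) → GivenBy.edges≡ g) inner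
          (r , refl , B)))

    finish : ∀ σ → Outer σ × register σ 7 ≡ suc lifetime → Static σ × Blank σ
    finish σ (((g , τ≡ , b) , B) , end) = (g , τ≡ , record
      { lists    = lists
      ; complete = λ {e} → listed (inj₁
          (subst₂ _<_ (sym (GivenBy.time≡ g e)) (sym end) (s≤s (time≤lifetime e))))
      ; size     = ≤-trans (m≤m+n _ _) size
      }) , b
      where open Building B

  -- Correctness: one round of marking and searching

  τ : ℕ
  τ = lifetime

  -- `n` is the fuel: it bounds the number of tuples from `D` on, `D` included.
  record Trying (n : ℕ) (D : ℕ → ℕ) : Set where
    field
      digits  : Digits h D
      left    : τ ^ h ≤ n + numeral τ D h
      checked : ∀ d → Digits h d → numeral τ d h < numeral τ D h → Escapes h s z d

  record Marking (i epoch : ℕ) (mark D : ℕ → ℕ) : Set where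
    field
      recent : ∀ b → mark b ≤ epoch
      marked : ∀ j → j < i → mark (suc (D j)) ≡ epoch
      only   : ∀ b → mark b ≡ epoch → ∃[ j ] j < i × suc (D j) ≡ b

  mark-next : ∀ {i epoch mark D} → Marking i epoch mark D →
              Marking (suc i) epoch (mark [ suc (D i) ↦ epoch ]) D
  mark-next {i} {epoch} {mark} {D} M = record
    { recent = λ b → update-elim (_≤ epoch) mark (suc (D i)) b (λ _ → ≤-refl) (λ _ → recent b)
    ; marked = marked′
    ; only   = λ b → update-elim (λ e → e ≡ epoch → ∃[ j ] j < suc i × suc (D j) ≡ b) mark (suc (D i)) b
        (λ here _ → i , ≤-refl , here)
        (λ _ e → let j , j<i , at-b = only b e in j , m<n⇒m<1+n j<i , at-b)
    }
    where
    open Marking M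
    marked′ : ∀ j → j < suc i → (mark [ suc (D i) ↦ epoch ]) (suc (D j)) ≡ epoch
    marked′ j (s≤s j≤i) with m≤n⇒m<n∨m≡n j≤i
    ... | inj₁ j<i  = update-elim (_≡ epoch) mark (suc (D i)) (suc (D j))
      (λ _ → refl) (λ _ → marked j j<i)
    ... | inj₂ refl = updated mark (suc (D i))

  Frame : ℕ → State → Set
  Frame n σ = Static σ × register σ 14 ≡ 0 × Trying n (array σ 11)

  Marked : ℕ → State → Set
  Marked n σ = Frame n σ × Marking h (register σ 9) (array σ 12) (array σ 11)

  markDigits-correct : ∀ {n Y σ} → 1 ≤ Y → h ≤ Y → Frame n σ → (∀ b → array σ 12 b ≤ register σ 9) →
                       Halts markDigits σ (Marked n) (Y * markTime)
  markDigits-correct {n} {Y} 1≤Y h≤Y f recent = relax (linear 1≤Y h≤Y 8 11)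
    (straight (set 9 (inc (reg 9))) {λ σ → Inv (setRegister 6 0 σ)} (λ { _ refl → f , record
      { recent = λ b → m≤n⇒m≤1+n (recent b)
      ; marked = λ _ ()
      ; only   = λ b e → contradiction (≤-trans (≤-reflexive (sym e)) (recent b)) 1+n≰n
      } })
     andThen λ _ i → consequence
       (λ σ ((f , M) , end) → f , subst (λ i → Marking i (register σ 9) (array σ 12) (array σ 11)) end M)
       (loop 6 (reg 2) Inv (λ _ (((g , _) , _) , _) → GivenBy.h≡ g) body i))
    where
    Inv : State → Set
    Inv σ = Frame n σ × Marking (register σ 6) (register σ 9) (array σ 12) (array σ 11)

    body : ∀ σ → Inv σ → register σ 6 < h →
           Halts (store 12 (inc (arr 11 (reg 6))) (reg 9)) σ
             (λ σ′ → register σ′ 6 ≡ register σ 6 × Inv (increment 6 σ′)) 5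
    body σ (f , M) _ = straight (store 12 (inc (arr 11 (reg 6))) (reg 9)) (refl , f , mark-next M)

  Copied : ℕ → State → Set
  Copied i σ = ∀ j → j < i → array σ 8 j ≡ array σ 7 j

  copyHeads-correct : ∀ {n Y σ} → 1 ≤ Y → ∣V∣ ≤ Y → Marked n σ →
                      Halts copyHeads σ (λ σ′ → Marked n σ′ × Copied ∣V∣ σ′) (Y * copyTime)
  copyHeads-correct {n} {Y} 1≤Y V≤Y m = relax (linear 1≤Y V≤Y 5 10)
    (consequence (λ σ ((m , c) , end) → m , subst (λ i → Copied i σ) end c)
      (loop 6 (reg 0) Inv (λ _ ((((g , _) , _) , _) , _) → GivenBy.vertices≡ g) body (m , λ _ ())))
    where
    Inv : State → Set
    Inv σ = Marked n σ × Copied (register σ 6) σ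

    body : ∀ σ → Inv σ → register σ 6 < ∣V∣ →
           Halts (store 8 (reg 6) (arr 7 (reg 6))) σ
             (λ σ′ → register σ′ 6 ≡ register σ 6 × Inv (increment 6 σ′)) 4
    body σ (m , c) _ = straight (store 8 (reg 6) (arr 7 (reg 6))) (refl , m , λ j j≤ →
      update-elim (_≡ array σ 7 j) (array σ 8) (register σ 6) j (cong (array σ 7))
        λ i≢j → c j (≤∧≢⇒< (s≤s⁻¹ j≤) λ e → i≢j (sym e)))

  Unmarked : State → ℕ → Set
  Unmarked σ b = array σ 12 b ≢ register σ 9

  Exploring : ℕ → ℕ → State → Set
  Exploring n k σ = Marked n σ × register σ 10 ≤ register σ 11 ×
    Searching.Search {s} {z} (Unmarked σ) k (register σ 8) (array σ 3) (array σ 4) (array σ 5)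
      (array σ 8) (array σ 9) (array σ 10) (register σ 10) (register σ 11) (register σ 12)

  enqueueSource-correct : ∀ {n σ} → Marked n σ × Copied ∣V∣ σ →
    Halts enqueueSource σ (λ σ′ → Exploring n (suc (2 * register σ′ 8)) σ′) 12
  enqueueSource-correct {σ = σ} (m@(((g , _ , b) , _) , _) , c) = straight enqueueSource
    (λ { _ refl _ refl _ refl → m , z≤n , Searching.begin-search (Unmarked σ) (Built.lists b) s≢z
      (λ v → c (toℕ v) (toℕ<n v)) (GivenBy.s≡ g) refl refl })

  searchStep-correct : ∀ {n k} σ → Exploring n (suc k) σ → register σ 10 < register σ 11 →
                       Halts searchStep σ (Exploring n k) (bound searchStep)
  searchStep-correct {n} {k} σ (m@(((g , _ , b) , _) , _) , qh≤qt , S) qh<qt = straight searchStep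
    λ { _ refl _ refl →
      (λ { x≡0 _ refl → m , qh<qt , advance lists S qh<qt
        λ 1≤k _ e → contradiction (≤-trans 1≤k (≤-reflexive (trans (sym e) x≡0))) (λ ()) })
    , λ x≢0 →
      (λ { early _ refl → m , qh<qt , advance lists S qh<qt
        λ _ _ e → subst (λ x → array σ 5 x < array σ 10 (register σ 10)) e early })
    , λ late →
      (λ dead → m , qh≤qt , pop lists (slacken S) v≡ refl (n≢0⇒n>0 x≢0) (λ o → contradiction dead o))
    , λ { alive _ refl →
      (λ { y≡z _ refl → m , m≤n⇒m≤1+n qh≤qt , follow-edge x≢0 late alive (λ _ ()) (λ _ ())
        (λ _ → inj₂ (trans y≡z (GivenBy.z≡ g))) })
    , λ y≢z → m , m≤n⇒m≤1+n qh≤qt , follow-edge x≢0 late alive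
        (λ y≡z → contradiction (trans y≡z (sym (GivenBy.z≡ g))) y≢z) (λ f → f) inj₁ } }
    where
    open Searching {s} {z} (Unmarked σ)
    open Search S
    open Built b using (lists)
    open Lists lists using (sound)

    v = array σ 9 (register σ 10)
    x = array σ 8 v

    v′ : Vertex
    v′ = proj₁ (reached qh<qt)

    v≡ : v ≡ toℕ v′
    v≡ = proj₁ (proj₂ (reached qh<qt))

    x≤N : x ≤ register σ 8
    x≤N = subst (λ v → array σ 8 v ≤ register σ 8) (sym v≡) (cur≤ v′)

    last : Queued (array σ 9 [ register σ 11 ↦ array σ 4 x ])
             (array σ 10 [ register σ 11 ↦ array σ 5 x ])
             (suc (register σ 11)) (array σ 4 x) (array σ 5 x)
    last = register σ 11 , ≤-refl , updated (array σ 9) _ , updated (array σ 10) _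

    hops : ∀ e u w → Joins e u w → array σ 3 x ≡ toℕ u → array σ 5 x ≡ time e → x ≢ 0 →
           ¬ (array σ 5 x < array σ 10 (register σ 10)) → Unmarked σ (array σ 5 x) →
           Reachable w (array σ 5 x)
    hops e u w j us ts x≢0 late alive with toℕ-injective (trans (sym us) srcx)
      where
      srcx : array σ 3 x ≡ toℕ v′
      srcx = trans (cong (λ v → array σ 3 (array σ 8 v)) v≡)
        (cur-src v′ (subst (λ v → 1 ≤ array σ 8 v) v≡ (n≢0⇒n>0 x≢0)))
    ... | refl = subst (Reachable w) (sym ts)
      (hop (proj₂ (proj₂ (reached qh<qt))) j (subst (_ ≤_) ts (≮⇒≥ late))
        (subst (Unmarked σ) ts alive))

    follow-edge :
      x ≢ 0 → ¬ (array σ 5 x < array σ 10 (register σ 10)) → Unmarked σ (array σ 5 x) →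
      ∀ {found′} → (array σ 4 x ≡ toℕ z → found′ ≢ 0) → (register σ 12 ≢ 0 → found′ ≢ 0) →
      (found′ ≢ 0 → register σ 12 ≢ 0 ⊎ array σ 4 x ≡ toℕ z) →
      Search k (register σ 8) (array σ 3) (array σ 4) (array σ 5)
        (array σ 8 [ v ↦ array σ 6 x ])
        (array σ 9 [ register σ 11 ↦ array σ 4 x ]) (array σ 10 [ register σ 11 ↦ array σ 5 x ])
        (register σ 10) (suc (register σ 11)) found′
    follow-edge x≢0 late alive new-hit old-hit source =
      let e , u , w , j , us , ws , ts = sound (n≢0⇒n>0 x≢0) x≤N in
      -- The program removes the node before it adds the entry. The two write to different arrays,
      -- and in this order the entry that `consumed` asks for is already in the queue.
      pop lists
        (push lists S ws (hops e u w j us ts x≢0 late alive) new-hit old-hit source qh≤qt)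
        v≡ refl (n≢0⇒n>0 x≢0) (λ _ → last)

  Searched : ℕ → State → Set
  Searched n σ = Marked n σ × (register σ 12 ≢ 0 → Escapes h s z (array σ 11))
                            × (register σ 12 ≡ 0 → ¬ Escapes h s z (array σ 11))

  search-correct : ∀ {n Y σ} → 1 ≤ Y → ∣E∣ ≤ Y → Exploring n (suc (2 * register σ 8)) σ →
                   Halts search σ (Searched n) (Y * searchTime)
  search-correct {n} {Y} {σ} 1≤Y E≤Y i@((((_ , _ , b) , _) , _) , _) =
    relax time≤ (consequence finish (iterate (Exploring n) round i))
    where
    c = 3 + bound searchStep

    time≤ : 3 + suc (2 * register σ 8) * c ≤ Y * searchTime
    time≤ = both Y {3} {suc (2 * register σ 8) * c} (constant 1≤Y 3) (begin
      suc (2 * register σ 8) * c  ≤⟨ *-monoˡ-≤ c (s≤s (*-monoʳ-≤ 2 (Built.size b))) ⟩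
      suc (2 * (2 * ∣E∣)) * c     ≡⟨ cong (λ n → suc n * c) (*-assoc 2 2 ∣E∣) ⟨
      suc (4 * ∣E∣) * c           ≤⟨ *-monoˡ-≤ c (+-mono-≤ 1≤Y (*-monoʳ-≤ 4 E≤Y)) ⟩
      5 * Y * c                   ≡⟨ cong (_* c) (*-comm 5 Y) ⟩
      Y * 5 * c                   ≡⟨ *-assoc Y 5 c ⟩
      Y * (5 * c)                 ∎)
      where open ≤-Reasoning

    round : ∀ k σ → Exploring n k σ → register σ 10 < register σ 11 →
            ∃[ k′ ] k ≡ suc k′ × Halts searchStep σ (Exploring n k′) (bound searchStep)
    -- Without fuel, the potential forces the end of the queue to be at most its front.
    round zero σ (_ , _ , S) qh<qt = contradiction
      (≤-trans qh<qt (m+n≤o⇒n≤o _ (Searching.Search.potential S))) (<-irrefl refl)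
    round (suc k) σ i qh<qt = k , refl , searchStep-correct σ i qh<qt

    finish : ∀ σ → (∃[ k ] Exploring n k σ) × ¬ (register σ 10 < register σ 11) → Searched n σ
    finish σ ((_ , m@(((_ , _ , b) , _) , M) , _ , S) , done) =
      m , (λ f → let p , oks = reached⇒path complete S (≮⇒≥ done) f in
             p , All.map (λ ok j j<h e → ok (trans (cong (array σ 12) (sym e)) (marked j j<h))) oks)
        , λ f≡0 (p , avoids) → path⇒reached complete S (≮⇒≥ done) p
            (All.map (λ avoid e → let j , j<h , hit = only _ e in avoid j j<h hit) avoids) f≡0
      where
      open Searching {s} {z} (Unmarked σ)
      open Marking M
      open Built b using (complete)

  -- Correctness: advancing the tuple and enumerating all of them

  -- A carry of c into position i is due in adding 1 to the numeral of value m.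
  record Carrying (m i c : ℕ) (D : ℕ → ℕ) : Set where
    field
      digits : Digits h D
      bit    : c ≡ 0 ⊎ c ≡ 1
      total  : numeral τ D h + c * τ ^ i ≡ suc m

  module _ {m i c : ℕ} {D : ℕ → ℕ} (K : Carrying m i c D) (i<h : i < h) where
    open Carrying K

    private
      put : ∀ {x} → x < τ → Digits h (D [ i ↦ x ])
      put x<τ {j} j<h = update-elim (_< τ) D i j (λ _ → x<τ) (λ _ → digits j<h)

    carry-none : c ≢ 1 → Carrying m (suc i) c D
    carry-none c≢1 with bit
    ... | inj₁ refl = record { digits = digits ; bit = inj₁ refl ; total = total }
    ... | inj₂ c≡1  = contradiction c≡1 c≢1

    carry-stop : c ≡ 1 → suc (D i) < τ → Carrying m (suc i) 0 (D [ i ↦ suc (D i) ])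
    carry-stop refl room = record
      { digits = put room
      ; bit    = inj₁ refl
      ; total  = trans (+-identityʳ _) (+-cancelʳ-≡ (D i * p) _ _ (begin
          numeral τ D′ h + D i * p        ≡⟨ numeral-update τ D h i<h ⟩
          numeral τ D h + (p + D i * p)   ≡⟨ +-assoc (numeral τ D h) p _ ⟨
          numeral τ D h + p + D i * p     ≡⟨ cong (λ q → numeral τ D h + q + D i * p) (*-identityˡ p) ⟨
          numeral τ D h + 1 * p + D i * p ≡⟨ cong (_+ D i * p) total ⟩
          suc m + D i * p                 ∎))
      }
      where
      open ≡-Reasoning
      p  = τ ^ i
      D′ = D [ i ↦ suc (D i) ]

    carry-on : c ≡ 1 → ¬ suc (D i) < τ → Carrying m (suc i) c (D [ i ↦ 0 ])
    carry-on refl full = record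
      { digits = put 1≤lifetime
      ; bit    = inj₂ refl
      ; total  = begin
          numeral τ D′ h + 1 * (τ * p)   ≡⟨ cong (numeral τ D′ h +_) (*-identityˡ (τ * p)) ⟩
          numeral τ D′ h + τ * p         ≡⟨ cong (λ b → numeral τ D′ h + b * p) τ≡ ⟩
          numeral τ D′ h + (p + D i * p) ≡⟨ cong (numeral τ D′ h +_) (+-comm p _) ⟩
          numeral τ D′ h + (D i * p + p) ≡⟨ +-assoc (numeral τ D′ h) _ _ ⟨
          numeral τ D′ h + D i * p + p   ≡⟨ cong (_+ p) (numeral-update τ D h i<h) ⟩
          numeral τ D h + 0 + p          ≡⟨ cong (_+ p) (+-identityʳ (numeral τ D h)) ⟩
          numeral τ D h + p              ≡⟨ cong (numeral τ D h +_) (*-identityˡ p) ⟨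
          numeral τ D h + 1 * p          ≡⟨ total ⟩
          suc m                          ∎
      }
      where
      open ≡-Reasoning
      p  = τ ^ i
      D′ = D [ i ↦ 0 ]

      τ≡ : τ ≡ suc (D i)
      τ≡ = ≤-antisym (≮⇒≥ full) (digits i<h)

  Checked : ℕ → Set
  Checked m = ∀ d → Digits h d → numeral τ d h ≤ m → Escapes h s z d

  -- A tuple with the same numeral agrees with `D` in all `h` digits, so the path that escapes `D`
  -- escapes it as well.
  checked : ∀ {n D} → Trying n D → Escapes h s z D → Checked (numeral τ D h)
  checked t esc d d< ≤m with m≤n⇒m<n∨m≡n ≤m
  ... | inj₁ <m = Trying.checked t d d< <m
  ... | inj₂ ≡m = Escapes-cong h
    (λ j<h → sym (numeral-injective τ h (λ {j} → d< {j}) (λ {j} → Trying.digits t {j}) ≡m j<h)) esc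

  Counting : ℕ → ℕ → State → Set
  Counting m i σ =
    (Static σ × (∀ b → array σ 12 b ≤ register σ 9) × register σ 14 ≡ 0 × register σ 12 ≢ 0) ×
    Carrying m i (register σ 13) (array σ 11)

  successor-correct : ∀ {m Y σ} → 1 ≤ Y → h ≤ Y →
    Counting m 0 (setRegister 13 1 σ) →
    Halts successor σ (Counting m h) (Y * successorTime)
  successor-correct {m} {Y} {σ} 1≤Y h≤Y start′ = relax
    (subst (λ b → 7 + h * b ≤ Y * successorTime) (cong (3 +_) (+-comm 3 (bound carryDigit)))
      (linear 1≤Y h≤Y 7 (6 + bound carryDigit)))
    (straight (set 13 (lit 1)) {λ σ → Inv (setRegister 6 0 σ)} (λ { _ refl → start′ })
     andThen λ _ i → consequence
       (λ σ ((r , K) , end) → r , subst (λ i → Carrying m i (register σ 13) (array σ 11)) end K)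
       (loop 6 (reg 2) Inv (λ _ (((g , _) , _) , _) → GivenBy.h≡ g) body i))
    where
    Inv : State → Set
    Inv σ = Counting m (register σ 6) σ

    body : ∀ σ → Inv σ → register σ 6 < h →
           Halts carryDigit σ (λ σ′ → register σ′ 6 ≡ register σ 6 × Inv (increment 6 σ′))
                 (bound carryDigit)
    body σ (r@((g , τ≡ , _) , _) , K) i<h = straight carryDigit
      ( (λ c≡1 → (λ room → λ { _ refl → refl , r , carry-stop K i<h c≡1 (subst (_ <_) τ≡ room) })
               , λ full → refl , r , carry-on K i<h c≡1 (subst (λ t → ¬ _ < t) τ≡ full))
      , λ c≢1 → refl , r , carry-none K i<h c≢1)

  Decided : ℕ → Set
  Decided found = (found ≡ 0 × HasSnapshotCut h s z) ⊎ (found ≢ 0 × ¬ HasSnapshotCut h s z)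

  Enumerating : ℕ → State → Set
  Enumerating n σ = (Static σ × ∀ b → array σ 12 b ≤ register σ 9) ×
    ((register σ 14 ≡ 0 × Trying n (array σ 11)) ⊎ (register σ 14 ≡ 1 × Decided (register σ 12)))

  continue-or-stop : ∀ {n Y σ} → 1 ≤ Y → h ≤ Y → Searched (suc n) σ →
    Halts (cond (eq (reg 12) (lit 0)) (set 14 (lit 1))
                (successor ⨾ cond (eq (reg 13) (lit 0)) skip (set 14 (lit 1))))
          σ (Enumerating n) (Y * decideTime)
  continue-or-stop {n} {Y} {σ} 1≤Y h≤Y ((((st , zero14 , t)) , M) , esc , ¬esc) =
    relax (both Y (constant 1≤Y 3) (both Y (constant 1≤Y 2) (both Y ≤-refl (constant 1≤Y 6))))
      (branch (eq (reg 12) (lit 0))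
        (λ f≡0 → straight (set 14 (lit 1)) λ { _ refl → (st , recent) ,
          inj₂ (refl , inj₁ (f≡0 , ¬escapes⇒cut h (Trying.digits t) (¬esc f≡0))) })
        λ f≢0 → successor-correct 1≤Y h≤Y ((st , recent , zero14 , f≢0) , record
            { digits = Trying.digits t
            ; bit    = inj₂ refl
            ; total  = +-comm _ 1
            })
          andThen decide (checked t (esc f≢0)))
    where
    open Marking M using (recent)

    m : ℕ
    m = numeral τ (array σ 11) h

    decide : Checked m → ∀ σ → Counting m h σ →
             Halts (cond (eq (reg 13) (lit 0)) skip (set 14 (lit 1))) σ (Enumerating n) 6
    decide ch σ ((st , recent , zero14 , f≢0) , K) =
      straight (cond (eq (reg 13) (lit 0)) skip (set 14 (lit 1)))
      ( (λ c≡0 → (st , recent) , inj₁ (zero14 , record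
            { digits  = digits
            ; left    = ≤-trans (Trying.left t)
                (≤-reflexive (trans (sym (+-suc n m)) (cong (n +_) (sym (value≡ c≡0)))))
            ; checked = λ d d< d<D → ch d d< (s≤s⁻¹ (subst (numeral τ d h <_) (value≡ c≡0) d<D))
            }))
      -- A carry out of the top digit gives `τ ^ h ≤ suc m`, so every numeral is at most `m` and all
      -- tuples have been checked.
      , λ { c≢0 _ refl → (st , recent) , inj₂ (refl , inj₂ (f≢0 , escapes⇒¬cut h λ d d< → ch d d<
          (s≤s⁻¹ (≤-trans (numeral< τ h d<) (overflow c≢0))))) })
      where
      open Carrying K

      value≡ : register σ 13 ≡ 0 → numeral τ (array σ 11) h ≡ suc m
      value≡ c≡0 = begin
        numeral τ (array σ 11) h                         ≡⟨ +-identityʳ _ ⟨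
        numeral τ (array σ 11) h + 0 * τ ^ h             ≡⟨ cong (λ c → _ + c * τ ^ h) c≡0 ⟨
        numeral τ (array σ 11) h + register σ 13 * τ ^ h ≡⟨ total ⟩
        suc m                                            ∎
        where open ≡-Reasoning

      overflow : register σ 13 ≢ 0 → τ ^ h ≤ suc m
      overflow c≢0 with bit
      ... | inj₁ c≡0 = contradiction c≡0 c≢0
      ... | inj₂ c≡1 = begin
        τ ^ h                                            ≡⟨ *-identityˡ (τ ^ h) ⟨
        1 * τ ^ h                                        ≡⟨ cong (_* τ ^ h) c≡1 ⟨
        register σ 13 * τ ^ h                            ≤⟨ m≤n+m _ _ ⟩
        numeral τ (array σ 11) h + register σ 13 * τ ^ h ≡⟨ total ⟩
        suc m                                            ∎
        where open ≤-Reasoning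

  tryDigits-correct : ∀ {n Y} → 1 ≤ Y → ∣V∣ ≤ Y → ∣E∣ ≤ Y → h ≤ Y →
    ∀ σ → Enumerating n σ → register σ 14 ≡ 0 →
    ∃[ n′ ] n ≡ suc n′ × Halts tryDigits σ (Enumerating n′) (Y * roundTime)
  tryDigits-correct _ _ _ _ _ (_ , inj₂ (one14 , _)) zero14 =
    contradiction (trans (sym zero14) one14) λ ()
  -- Fuel 0 would require a numeral of at least `τ ^ h`.
  tryDigits-correct {zero} _ _ _ _ _ (_ , inj₁ (_ , t)) _ =
    contradiction (numeral< τ h (Trying.digits t)) (≤⇒≯ (Trying.left t))
  tryDigits-correct {suc n} {Y} 1≤Y V≤Y E≤Y h≤Y σ ((st , recent) , inj₁ (zero14 , t)) _ =
    n , refl , relax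
      (both Y {c = markTime} ≤-refl (both Y {c = copyTime} ≤-refl (both Y (constant 1≤Y 12)
        (both Y {c = searchTime} {decideTime} ≤-refl ≤-refl))))
      (markDigits-correct 1≤Y h≤Y (st , zero14 , t) recent
       andThen λ _ m → copyHeads-correct 1≤Y V≤Y m
       andThen λ _ c → enqueueSource-correct c
       andThen λ _ e → search-correct 1≤Y E≤Y e
       andThen λ _ r → continue-or-stop 1≤Y h≤Y r)

  numeral-zero : ∀ {d} n → (∀ j → d j ≡ 0) → numeral τ d n ≡ 0
  numeral-zero zero    d≡0 = refl
  numeral-zero (suc n) d≡0 rewrite d≡0 n = trans (+-identityʳ _) (numeral-zero n d≡0)

  -- The whole program and its running time

  Answer : State → Set
  Answer σ = (output σ ≡ 1 × HasSnapshotCut h s z) ⊎ (output σ ≡ 0 × ¬ HasSnapshotCut h s z)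

  input-given : Given (input G h s z) × Blank (input G h s z) × Empty (input G h s z)
  input-given = record
    { vertices≡ = refl ; edges≡ = refl ; h≡ = refl ; s≡ = refl ; z≡ = refl
    ; ends₁≡ = toArray-toℕ _ ; ends₂≡ = toArray-toℕ _ ; time≡ = toArray-toℕ _
    } , ((λ _ → z≤n) , (λ _ → refl) , refl) , (λ _ → refl) , refl

  X Y : ℕ
  Y = ∣V∣ + ∣E∣
  X = τ ^ h * Y

  1≤Y : 1 ≤ Y
  1≤Y = ≤-trans (s≤s z≤n) (≤-trans (toℕ<n s) (m≤m+n ∣V∣ ∣E∣))

  instance
    τ≢0 : NonZero τ
    τ≢0 = >-nonZero 1≤lifetime

  1≤τ^h : 1 ≤ τ ^ h
  1≤τ^h = m^n>0 τ h

  1≤X : 1 ≤ X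
  1≤X = *-mono-≤ 1≤τ^h 1≤Y

  Y≤X : Y ≤ X
  Y≤X = ≤-trans (≤-reflexive (sym (*-identityˡ Y))) (*-monoˡ-≤ Y 1≤τ^h)

  -- Pays for the scans of `buildLists`; this is where `1≤h` enters.
  τ<2τ^h : τ < τ ^ h * 2
  τ<2τ^h = begin
    1 + τ         ≤⟨ +-mono-≤ 1≤τ^h (≤-trans (≤-reflexive (sym (^-identityʳ τ))) (^-monoʳ-≤ τ 1≤h)) ⟩
    τ ^ h + τ ^ h ≡⟨ cong (τ ^ h +_) (*-identityʳ (τ ^ h)) ⟨
    τ ^ h + τ ^ h * 1 ≡⟨ *-suc (τ ^ h) 1 ⟨
    τ ^ h * 2     ∎
    where open ≤-Reasoning

  start-enumerating : ∀ σ → Static σ × Blank σ → Enumerating (τ ^ h) σ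
  start-enumerating σ (st , recent , zeros , zero14) = (st , recent) , inj₁ (zero14 , record
    { digits  = λ {j} _ → subst (_< τ) (sym (zeros j)) 1≤lifetime
    ; left    = m≤m+n _ _
    ; checked = λ d _ d<D → contradiction (subst (numeral τ d h <_) (numeral-zero h zeros) d<D) λ ()
    })

  enumerate-correct : ∣E∣ ≤ Y → h ≤ Y → ∀ σ → Static σ × Blank σ →
    Halts (while (eq (reg 14) (lit 0)) tryDigits) σ (λ σ′ → Decided (register σ′ 12))
          (X * enumerateTime)
  enumerate-correct E≤Y h≤Y σ i = relax
    (bilinear {τ ^ h} {Y} 1≤X (m≤m*n (τ ^ h) 2) 3 3 {k = roundTime} ≤-refl 1≤Y)
    (consequence finish
      (iterate Enumerating (λ _ → tryDigits-correct 1≤Y (m≤m+n ∣V∣ ∣E∣) E≤Y h≤Y)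
        (start-enumerating σ i)))
    where
    finish : ∀ σ → (∃[ n ] Enumerating n σ) × ¬ (register σ 14 ≡ 0) → Decided (register σ 12)
    finish σ ((_ , _ , inj₁ (zero14 , _)) , done) = contradiction zero14 done
    finish σ ((_ , _ , inj₂ (_ , d)) , _)         = d

  answer : ∀ σ → Decided (register σ 12) →
           Halts (cond (eq (reg 12) (lit 0)) (set 0 (lit 1)) (set 0 (lit 0))) σ Answer 7
  answer σ d = straight (cond (eq (reg 12) (lit 0)) (set 0 (lit 1)) (set 0 (lit 0)))
    ( (λ { f≡0 _ refl → inj₁ (refl , positive d f≡0) })
    , λ { f≢0 _ refl → inj₂ (refl , negative d f≢0) })
    where
    positive : ∀ {f} → Decided f → f ≡ 0 → HasSnapshotCut h s z
    positive (inj₁ (_ , cut)) _   = cut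
    positive (inj₂ (f≢0 , _)) f≡0 = contradiction f≡0 f≢0

    negative : ∀ {f} → Decided f → f ≢ 0 → ¬ HasSnapshotCut h s z
    negative (inj₁ (f≡0 , _))  f≢0 = contradiction f≡0 f≢0
    negative (inj₂ (_ , ¬cut)) _   = ¬cut

  program-correct : Halts program (input G h s z) Answer (X * totalTime)
  program-correct = relax
    (both X {c = 3} (constant 1≤X 3)
      (both X {c = lifetimeTime + (buildTime + (enumerateTime + 7))} {2}
        (both X {c = lifetimeTime} ≤-refl (both X {c = buildTime} ≤-refl
          (both X {c = enumerateTime} ≤-refl (constant 1≤X 7))))
        (constant 1≤X 2)))
    (branch (lt (reg 2) (reg 1))
      (λ h<E → findLifetime-correct 1≤X (≤-trans E≤Y Y≤X) input-given
        andThen λ _ i → buildLists-correct {τ ^ h} {Y} 1≤X 1≤Y E≤Y τ<2τ^h i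
        andThen λ σ i → enumerate-correct E≤Y (≤-trans (<⇒≤ h<E) E≤Y) σ i
        andThen answer)
      λ h≮E → straight (set 0 (lit 1)) λ { _ refl → inj₁ (refl , all-times-cut s≢z (≮⇒≥ h≮E)) })
    where
    E≤Y : ∣E∣ ≤ Y
    E≤Y = m≤n+m ∣E∣ ∣V∣

theorem4 : ∃[ P ] ∃[ C ] ((G : TemporalGraph) → let open TemporalGraph G in
    (h : ℕ) → 1 ≤ h → (s z : Vertex) → s ≢ z →
    ∃[ σ ] ∃[ t ]
    ⟨ P , input G h s z ⟩⇓⟨ σ , t ⟩
    × t ≤ C * (lifetime ^ h * (∣V∣ + ∣E∣))
    × ((output σ ≡ 1 × HasSnapshotCut h s z)
    ⊎ (output σ ≡ 0 × ¬ HasSnapshotCut h s z)))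
theorem4 = program , totalTime , λ G h 1≤h s z s≢z →
  relax (≤-reflexive (*-comm (TemporalGraph.lifetime G ^ h * _) totalTime))
    (Deciding.program-correct G h 1≤h s z s≢z)
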